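{- For any $h\ge 1$, the generating function $$f_h(x,y)=\sum_{W\in W_{(0,h-1)}(\mathcal G_h)}x^{|W|}y^{\|W\|}$$ that counts growing self-avoiding walks on $\mathcal G_h$ that start in the top-left corner $(0,h-1)$ by length and displacement is rational.
   Context: $\mathcal G_h$ is the half-infinite grid graph with vertex set $\mathbb N\times\{0,\dots,h-1\}$ ($0\in\mathbb N$), with an edge between two points exactly when they are at Euclidean distance $1$. A growing self-avoiding walk (GSAW) on a graph is a finite directed walk that visits no vertex twice and whose final vertex is trapped, i.e. all of its neighbors are visited by the walk. $W_v(G)$ denotes the set of GSAWs on $G$ starting at the vertex $v$. $|W|$ is the length of $W$ (number of edges) and $\|W\|$ is its displacement (difference between the largest and smallest $x$-coordinates of its vertices). "Rational" means that the formal power series equals a quotient of two polynomials. -}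

module Defs where

open import Level using (0ℓ)
open import Data.Nat.Base as ℕ using (ℕ; zero; suc; _+_; _*_; _∸_; _^_; _≤_; _<_; _⊔_; _⊓_; z≤n; s≤s; NonZero; ∣_-_∣)
import Data.Nat.Properties as ℕ
open import Data.Integer.Base as ℤ using (ℤ; +_; 0ℤ)
import Data.Integer.Properties as ℤ
open import Data.Fin.Base using (Fin; toℕ; fromℕ)
import Data.Fin.Properties as Fin
open import Data.List.Base using (List; []; _∷_; length; cartesianProduct; cartesianProductWith; filter; map; upTo; allFin)
open import Data.List.NonEmpty.Base as List⁺ using (List⁺; _∷_; toList; head; tail; last; foldr₁)
open import Data.List.Membership.Propositional using (_∈_)
open import Data.List.Membership.Propositional.Properties using (∈-cartesianProduct⁺; ∈-cartesianProductWith⁺; ∈-upTo⁺; ∈-allFin; ∈-map⁺; ∈-filter⁺; ∈-filter⁻)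
open import Data.List.Relation.Unary.All as All using (All; []; _∷_)
open import Data.List.Relation.Unary.Any using (here)
open import Data.List.Relation.Unary.Linked using (Linked; []; [-]; _∷_; linked?)
open import Data.List.Relation.Unary.AllPairs using ([]; _∷_)
open import Data.List.Relation.Unary.Unique.Propositional using (Unique)
import Data.List.Relation.Unary.Unique.Propositional.Properties as Unique
import Data.List.Relation.Unary.Unique.DecPropositional as DecUnique
import Data.List.Membership.DecPropositional as DecMembership
open import Data.List.Properties using (∷-injective)
open import Data.Product.Base using (_×_; _,_; proj₁; proj₂; ∃-syntax; ∃₂)
open import Data.Product.Properties using (≡-dec)
open import Data.Sum.Base using (_⊎_)
open import Function.Bundles using (_⇔_; mk⇔)
open import Relation.Binary.Core using (Rel)
open import Relation.Binary.Definitions using (DecidableEquality; Decidable)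
open import Relation.Binary.PropositionalEquality using (_≡_; _≢_; refl; sym; cong; subst)
open import Relation.Nullary.Decidable using (Dec; map′; _×-dec_; _→-dec_)
import Relation.Unary as U
open import Algebra.Properties.Semiring.Sum ℤ.+-*-semiring using (sum)

-- Graphs are simple, so a walk is given by the sequence of its vertices.

record IsGSAW {V : Set} (_~_ : Rel V 0ℓ) (W : List⁺ V) : Set where
  constructor mkGSAW
  field
    isWalk       : Linked _~_ (toList W)
    selfAvoiding : Unique (toList W)
    trapped      : ∀ u → last W ~ u → u ∈ toList W

GSAWFrom : {V : Set} → Rel V 0ℓ → V → U.Pred (List⁺ V) 0ℓ
GSAWFrom _~_ v W = IsGSAW _~_ W × head W ≡ v

-- The number of edges, one less than the number of vertices.
∣_∣ʷ : {V : Set} → List⁺ V → ℕ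
∣ W ∣ʷ = length (tail W)

Vertex : ℕ → Set
Vertex h = ℕ × Fin h

-- Euclidean distance 1 is squared distance 1, which stays within ℕ.
Adjacent : ∀ {h} → Rel (Vertex h) 0ℓ
Adjacent (x , y) (x′ , y′) = ∣ x - x′ ∣ ^ 2 + ∣ toℕ y - toℕ y′ ∣ ^ 2 ≡ 1

topLeft : ∀ h → .{{NonZero h}} → Vertex h
topLeft (suc k) = 0 , fromℕ k

∥_∥ : ∀ {h} → List⁺ (Vertex h) → ℕ
∥ W ∥ = foldr₁ _⊔_ xs ∸ foldr₁ _⊓_ xs
  where xs = List⁺.map proj₁ W

CornerGSAW : ∀ h → .{{NonZero h}} → ℕ → ℕ → U.Pred (List⁺ (Vertex h)) 0ℓ
CornerGSAW h n d W = GSAWFrom Adjacent (topLeft h) W × ∣ W ∣ʷ ≡ n × ∥ W ∥ ≡ d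

record Enumeration {A : Set} (P : U.Pred A 0ℓ) : Set where
  field
    elements : List A
    unique   : Unique elements
    exact    : ∀ a → a ∈ elements ⇔ P a

  cardinality : ℕ
  cardinality = length elements

-- The walks counted by a coefficient of the generating function form a finite
-- set: a walk with n edges from the corner stays within the first n + 1
-- columns, so a finite search finds them all.
module _ {h : ℕ} where

  private
    _≟ᵛ_ : DecidableEquality (Vertex h)
    _≟ᵛ_ = ≡-dec ℕ._≟_ Fin._≟_

    adjacent? : Decidable (Adjacent {h})
    adjacent? (x , y) (x′ , y′) = _ ℕ.≟ 1

    open DecMembership _≟ᵛ_ using (_∈?_)
    open DecUnique _≟ᵛ_ using (unique?)

    columns : ℕ → List (Vertex h)
    columns n = cartesianProduct (upTo n) (allFin h)

    ∈-columns : ∀ {n} (u : Vertex h) → proj₁ u < n → u ∈ columns n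
    ∈-columns (x , y) x<n = ∈-cartesianProduct⁺ (∈-upTo⁺ x<n) (∈-allFin y)

    columns-unique : ∀ n → Unique (columns n)
    columns-unique n = Unique.cartesianProduct⁺ (Unique.upTo⁺ n) (Unique.allFin⁺ h)

    m≤m^2 : ∀ m → m ≤ m ^ 2
    m≤m^2 zero    = z≤n
    m≤m^2 (suc m) = ℕ.m≤m*n (suc m) (suc m * 1)

    adjacent⇒≤ : ∀ (u v : Vertex h) → Adjacent u v → proj₁ v ≤ suc (proj₁ u)
    adjacent⇒≤ (x , y) (x′ , y′) uv = begin
      x′                ≤⟨ ℕ.m≤n+∣n-m∣ x′ x ⟩
      x + ∣ x - x′ ∣     ≤⟨ ℕ.+-monoʳ-≤ x (ℕ.≤-trans (m≤m^2 ∣ x - x′ ∣) (ℕ.m≤m+n _ _)) ⟩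
      x + (∣ x - x′ ∣ ^ 2 + ∣ toℕ y - toℕ y′ ∣ ^ 2) ≡⟨ cong (_+_ x) uv ⟩
      x + 1             ≡⟨ ℕ.+-comm x 1 ⟩
      suc x             ∎
      where open ℕ.≤-Reasoning

    walk-bounded : ∀ u vs → Linked Adjacent (u ∷ vs) →
                   All (λ v → proj₁ v ≤ proj₁ u + length vs) vs
    walk-bounded u []       _          = []
    walk-bounded u (v ∷ vs) (uv ∷ vvs) =
      ℕ.≤-trans (ℕ.m≤m+n (proj₁ v) (length vs)) v+≤ ∷
      All.map (λ w≤ → ℕ.≤-trans w≤ v+≤) (walk-bounded v vs vvs)
      where
      v+≤ : proj₁ v + length vs ≤ proj₁ u + suc (length vs)
      v+≤ = ℕ.≤-trans (ℕ.+-monoˡ-≤ (length vs) (adjacent⇒≤ u v uv))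
                      (ℕ.≤-reflexive (sym (ℕ.+-suc (proj₁ u) (length vs))))

    trapped? : ∀ (W : List⁺ (Vertex h)) →
               Dec (∀ u → Adjacent (last W) u → u ∈ toList W)
    trapped? W =
      map′ (λ near u ℓu → All.lookup near (∈-columns u (s≤s (adjacent⇒≤ (last W) u ℓu))) ℓu)
           (λ all → All.universal all _)
           (All.all? (λ u → adjacent? (last W) u →-dec u ∈? toList W)
                     (columns (suc (suc (proj₁ (last W))))))

    isGSAW? : U.Decidable (IsGSAW (Adjacent {h}))
    isGSAW? W =
      map′ (λ (w , s , t) → mkGSAW w s t) (λ (mkGSAW w s t) → w , s , t)
           (linked? adjacent? (toList W) ×-dec unique? (toList W) ×-dec trapped? W)

    words : List (Vertex h) → ℕ → List (List (Vertex h))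
    words vs zero    = [] ∷ []
    words vs (suc n) = cartesianProductWith _∷_ vs (words vs n)

    words-unique : ∀ {vs} → Unique vs → ∀ n → Unique (words vs n)
    words-unique vs! zero    = [] ∷ []
    words-unique vs! (suc n) =
      Unique.cartesianProductWith⁺ _∷_ ∷-injective vs! (words-unique vs! n)

    ∈-words : ∀ {vs ws} → All (_∈ vs) ws → ws ∈ words vs (length ws)
    ∈-words []         = here refl
    ∈-words (w∈ ∷ ws∈) = ∈-cartesianProductWith⁺ _∷_ w∈ (∈-words ws∈)

  cornerGSAWs : .{{_ : NonZero h}} → ∀ n d → Enumeration (CornerGSAW h n d)
  cornerGSAWs n d = record
    { elements = filter good? candidates
    ; unique   = Unique.filter⁺ good?
                   (Unique.map⁺ (cong tail) (words-unique (columns-unique (suc n)) n))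
    ; exact    = λ W → mk⇔ (λ W∈ → proj₂ (∈-filter⁻ good? {xs = candidates} W∈))
                           (λ good → ∈-filter⁺ good? (candidate W good) good)
    }
    where
    candidates : List (List⁺ (Vertex h))
    candidates = map (topLeft h ∷_) (words (columns (suc n)) n)

    good? : U.Decidable (CornerGSAW h n d)
    good? W = (isGSAW? W ×-dec head W ≟ᵛ topLeft h) ×-dec
              ∣ W ∣ʷ ℕ.≟ n ×-dec ∥ W ∥ ℕ.≟ d

    topLeft-x : ∀ k → .{{_ : NonZero k}} → proj₁ (topLeft k) ≡ 0
    topLeft-x (suc k) = refl

    candidate : ∀ W → CornerGSAW h n d W → W ∈ candidates
    candidate (_ ∷ vs) ((gsaw , refl) , refl , _) =
      ∈-map⁺ (topLeft h ∷_) (∈-words (All.map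
        (λ {v} v≤ → ∈-columns v (s≤s (subst (λ x → proj₁ v ≤ x + length vs) (topLeft-x h) v≤)))
        (walk-bounded (topLeft h) vs (IsGSAW.isWalk gsaw))))

-- The value at (i , j) is the coefficient of xⁱ yʲ.
PowerSeries : Set
PowerSeries = ℕ → ℕ → ℤ

infix 4 _≋_
_≋_ : Rel PowerSeries 0ℓ
F ≋ G = ∀ i j → F i j ≡ G i j

infixl 7 _⊛_
_⊛_ : PowerSeries → PowerSeries → PowerSeries
(F ⊛ G) i j =
  sum {suc i} λ a → sum {suc j} λ b →
    F (toℕ a) (toℕ b) ℤ.* G (i ∸ toℕ a) (j ∸ toℕ b)

IsPolynomial : U.Pred PowerSeries 0ℓ
IsPolynomial P = ∃[ N ] ∀ i j → N ≤ i ⊎ N ≤ j → P i j ≡ 0ℤ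

-- F = P / Q as an equation in the fraction field of the domain ℤ[[x, y]].
-- Fractions of polynomials over ℚ have integral numerator and denominator
-- after clearing denominators, so ℤ coefficients lose nothing.
IsRational : U.Pred PowerSeries 0ℓ
IsRational F = ∃₂ λ P Q →
  IsPolynomial P × IsPolynomial Q × (∃₂ λ i j → Q i j ≢ 0ℤ) × Q ⊛ F ≋ P

gsawSeries : ∀ h → .{{NonZero h}} → PowerSeries
gsawSeries h n d = + Enumeration.cardinality (cornerGSAWs {h} n d)

{-# OPTIONS --safe #-}
module Submission where

-- Transfer matrices.  The trace of a walk on column k lists its heights there, in the
-- order of the walk, with marks L and R for the excursions to the left and to the
-- right.  There are finitely many traces, and a walk is recovered from its traces on
-- consecutive columns, since these agree on the heights and the order in which the
-- walk crosses from one column to the next.  Whether the last vertex is trapped can be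
-- read off from its column and the two neighbouring ones.  Hence, if F b counts the
-- pieces of walks to the right of a column with trace b, by vertices and columns,
-- F b = v b + y Σ x^|c| F c, over the traces c that can follow b.  The
-- determinant of this finite linear system has constant coefficient 1, so its
-- solutions are rational.  A walk from the corner is a piece to the right of a fictitious
-- fully visited column which is left once, at the top height; bounding its columns by d
-- instead of prescribing the displacement costs a factor 1 - y.

open import Defs
open import Algebra.Bundles using (CommutativeMonoid; CommutativeRing)
import Algebra.Properties.CommutativeSemigroup as CommutativeSemigroupProperties
import Algebra.Properties.Ring as RingProperties
open import Algebra.Properties.Semiring.Sum using (sum-cong-≋; sum-replicate-zero) renaming (sum to sumFin)
open import Data.Bool.Base using (true; false; if_then_else_)
open import Data.Empty using (⊥-elim)
open import Data.Fin.Base using (Fin; toℕ; fromℕ)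
import Data.Fin.Properties as Fin
open import Data.Integer.Base as ℤ using (ℤ; +_; 0ℤ; 1ℤ)
import Data.Integer.Properties as ℤ
open import Data.List.Base
  using (List; []; _∷_; [_]; _++_; _∷ʳ_; length; map; catMaybes; filter; allFin;
         cartesianProductWith; initLast; _∷ʳ′_)
open import Data.List.Membership.Propositional using (_∈_)
import Data.List.Membership.DecPropositional as DecMembership
open import Data.List.Membership.Propositional.Properties
  using (∈-++⁺ˡ; ∈-++⁺ʳ; ∈-++⁻; ∈-∃++; ∈-map⁺; ∈-map⁻; ∈-filter⁺; ∈-filter⁻; ∈-allFin;
         ∈-cartesianProductWith⁺; ∈-cartesianProductWith⁻)
open import Data.List.NonEmpty.Base using (List⁺; _∷_; toList; last; foldr₁)
import Data.List.Properties as List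
open import Data.List.Properties using (length-++; length-map; ∷-injective)
open import Data.List.Relation.Binary.Permutation.Propositional using (_↭_; ↭-refl; prep; ↭-sym; ↭-trans; ↭⇒↭ₛ)
open import Data.List.Relation.Binary.Permutation.Propositional.Properties
  using (∈-resp-↭; All-resp-↭; ↭-length) renaming (shift to ↭-shift)
import Data.List.Relation.Binary.Permutation.Setoid.Properties as PermutationSetoid
open import Data.List.Relation.Binary.Subset.Propositional using (_⊆_)
open import Data.List.Relation.Unary.All as All using (All; []; _∷_)
import Data.List.Relation.Unary.All.Properties as All
open import Data.List.Relation.Unary.AllPairs using ([]; _∷_)
open import Data.List.Relation.Unary.Any using (here; there)
open import Data.List.Relation.Unary.Linked using (Linked; [-]; _∷_; linked?)
open import Data.List.Relation.Unary.Unique.Propositional using (Unique)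
import Data.List.Relation.Unary.Unique.Propositional.Properties as Unique
import Data.List.Relation.Unary.Unique.DecPropositional as DecUnique
open import Data.Maybe.Base using (Maybe; just; nothing)
open import Data.Maybe.Properties using (just-injective)
open import Data.Nat.Base as ℕ
  using (ℕ; zero; suc; _≤_; _<_; _⊔_; _⊓_; _∸_; _^_; ∣_-_∣; z≤n; s≤s; NonZero)
open import Data.Nat.ListAction using (sum)
import Data.Nat.Properties as ℕ
open import Data.Product.Base using (_×_; _,_; proj₁; proj₂; ∃; ∃-syntax; ∃₂)
open import Data.Sum.Base as Sum using (_⊎_; inj₁; inj₂)
open import Function.Base using (_∘_; id)
open import Function.Bundles using (_⇔_; mk⇔; Equivalence)
open import Level using (0ℓ)
open import Relation.Binary.Core using (Rel)
open import Relation.Binary.Definitions using (DecidableEquality; Decidable)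
open import Relation.Binary.PropositionalEquality
  using (_≡_; _≢_; refl; sym; trans; cong; cong₂; subst) renaming (setoid to ≡-setoid)
import Relation.Binary.Reasoning.Setoid as SetoidReasoning
open import Relation.Nullary.Decidable using (Dec; yes; no; does; map′; _×-dec_; _→-dec_)
open import Relation.Nullary.Negation using (¬_; contradiction)
import Relation.Unary as U
open Equivalence using (to; from)

-- Power series

module Series {c ℓ} (R : CommutativeRing c ℓ) where
  open CommutativeRing R renaming (refl to ≈-refl; sym to ≈-sym; trans to ≈-trans)
  open CommutativeSemigroupProperties (CommutativeMonoid.commutativeSemigroup +-commutativeMonoid)
    using (interchange)
  open SetoidReasoning setoid

  infixl 7 _∙_ _·_

  -- The Cauchy product, unfolded along the left factor so that the ring laws become structural
  -- inductions.
  _∙_ : (ℕ → Carrier) → (ℕ → Carrier) → ℕ → Carrier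
  (F ∙ G) zero    = F 0 * G 0
  (F ∙ G) (suc n) = F 0 * G (suc n) + ((F ∘ suc) ∙ G) n

  _·_ : Carrier → (ℕ → Carrier) → ℕ → Carrier
  (r · G) n = r * G n

  constant : Carrier → ℕ → Carrier
  constant r zero    = r
  constant r (suc n) = 0#

  ∙-cong : ∀ {F F′ G G′} → (∀ n → F n ≈ F′ n) → (∀ n → G n ≈ G′ n) → ∀ n → (F ∙ G) n ≈ (F′ ∙ G′) n
  ∙-cong p q zero    = *-cong (p 0) (q 0)
  ∙-cong p q (suc n) = +-cong (*-cong (p 0) (q (suc n))) (∙-cong (p ∘ suc) q n)

  zero-∙ : ∀ {F} G → (∀ n → F n ≈ 0#) → ∀ n → (F ∙ G) n ≈ 0#
  zero-∙ G F≈0 zero    = ≈-trans (*-congʳ (F≈0 0)) (zeroˡ _)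
  zero-∙ G F≈0 (suc n) =
    ≈-trans (+-cong (≈-trans (*-congʳ (F≈0 0)) (zeroˡ _)) (zero-∙ G (F≈0 ∘ suc) n)) (+-identityˡ 0#)

  constant-∙ : ∀ r G n → (constant r ∙ G) n ≈ r * G n
  constant-∙ r G zero    = ≈-refl
  constant-∙ r G (suc n) = ≈-trans (+-congˡ (zero-∙ G (λ _ → ≈-refl) n)) (+-identityʳ _)

  ·-∙-assoc : ∀ r F G n → ((r · F) ∙ G) n ≈ r * (F ∙ G) n
  ·-∙-assoc r F G zero    = *-assoc r (F 0) (G 0)
  ·-∙-assoc r F G (suc n) = begin
    r * F 0 * G (suc n) + ((r · (F ∘ suc)) ∙ G) n   ≈⟨ +-cong (*-assoc _ _ _) (·-∙-assoc r (F ∘ suc) G n) ⟩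
    r * (F 0 * G (suc n)) + r * ((F ∘ suc) ∙ G) n   ≈⟨ distribˡ r _ _ ⟨
    r * (F 0 * G (suc n) + ((F ∘ suc) ∙ G) n)       ∎

  ∙-distribʳ : ∀ H F G n → ((λ k → F k + G k) ∙ H) n ≈ (F ∙ H) n + (G ∙ H) n
  ∙-distribʳ H F G zero    = distribʳ (H 0) (F 0) (G 0)
  ∙-distribʳ H F G (suc n) =
    ≈-trans (+-cong (distribʳ _ _ _) (∙-distribʳ H (F ∘ suc) (G ∘ suc) n)) (interchange _ _ _ _)

  -- `_∙_` computes along its left factor only. The induction for commutativity has to unfold it
  -- along the right one as well.
  ∙-suc : ∀ F G n → (F ∙ G) (suc n) ≈ (F ∙ (G ∘ suc)) n + F (suc n) * G 0
  ∙-suc F G zero    = ≈-refl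
  ∙-suc F G (suc n) = ≈-trans (+-congˡ (∙-suc (F ∘ suc) G n)) (≈-sym (+-assoc _ _ _))

  ∙-comm : ∀ F G n → (F ∙ G) n ≈ (G ∙ F) n
  ∙-comm F G zero    = *-comm (F 0) (G 0)
  ∙-comm F G (suc n) = begin
    F 0 * G (suc n) + ((F ∘ suc) ∙ G) n   ≈⟨ +-comm _ _ ⟩
    ((F ∘ suc) ∙ G) n + F 0 * G (suc n)   ≈⟨ +-cong (∙-comm (F ∘ suc) G n) (*-comm _ _) ⟩
    (G ∙ (F ∘ suc)) n + G (suc n) * F 0   ≈⟨ ∙-suc G F n ⟨
    (G ∙ F) (suc n)                       ∎

  ∙-assoc : ∀ F G H n → ((F ∙ G) ∙ H) n ≈ (F ∙ (G ∙ H)) n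
  ∙-assoc F G H zero    = *-assoc (F 0) (G 0) (H 0)
  ∙-assoc F G H (suc n) = begin
    F 0 * G 0 * H (suc n) + ((λ k → F 0 * G (suc k) + ((F ∘ suc) ∙ G) k) ∙ H) n
      ≈⟨ +-cong (*-assoc _ _ _) (∙-distribʳ H (F 0 · (G ∘ suc)) ((F ∘ suc) ∙ G) n) ⟩
    F 0 * (G 0 * H (suc n)) + (((F 0 · (G ∘ suc)) ∙ H) n + (((F ∘ suc) ∙ G) ∙ H) n)
      ≈⟨ +-congˡ (+-cong (·-∙-assoc (F 0) (G ∘ suc) H n) (∙-assoc (F ∘ suc) G H n)) ⟩
    F 0 * (G 0 * H (suc n)) + (F 0 * ((G ∘ suc) ∙ H) n + ((F ∘ suc) ∙ (G ∙ H)) n)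
      ≈⟨ +-assoc _ _ _ ⟨
    F 0 * (G 0 * H (suc n)) + F 0 * ((G ∘ suc) ∙ H) n + ((F ∘ suc) ∙ (G ∙ H)) n
      ≈⟨ +-congʳ (distribˡ (F 0) _ _) ⟨
    F 0 * (G 0 * H (suc n) + ((G ∘ suc) ∙ H) n) + ((F ∘ suc) ∙ (G ∙ H)) n ∎

  ∙-identityˡ : ∀ F n → (constant 1# ∙ F) n ≈ F n
  ∙-identityˡ F n = ≈-trans (constant-∙ 1# F n) (*-identityˡ (F n))

  seriesRing : CommutativeRing c ℓ
  seriesRing = record
    { Carrier = ℕ → Carrier
    ; _≈_ = λ F G → ∀ n → F n ≈ G n
    ; _+_ = λ F G n → F n + G n
    ; _*_ = _∙_
    ; -_ = λ F n → - F n
    ; 0# = λ _ → 0#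
    ; 1# = constant 1#
    ; isCommutativeRing = record
      { isRing = record
        { +-isAbelianGroup = record
          { isGroup = record
            { isMonoid = record
              { isSemigroup = record
                { isMagma = record
                  { isEquivalence = record
                    { refl = λ _ → ≈-refl ; sym = λ p n → ≈-sym (p n) ; trans = λ p q n → ≈-trans (p n) (q n) }
                  ; ∙-cong = λ p q n → +-cong (p n) (q n)
                  }
                ; assoc = λ F G H n → +-assoc (F n) (G n) (H n)
                }
              ; identity = (λ F n → +-identityˡ (F n)) , (λ F n → +-identityʳ (F n))
              }
            ; inverse = (λ F n → -‿inverseˡ (F n)) , (λ F n → -‿inverseʳ (F n))
            ; ⁻¹-cong = λ p n → -‿cong (p n)
            }
          ; comm = λ F G n → +-comm (F n) (G n)
          }
        ; *-cong = ∙-cong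
        ; *-assoc = ∙-assoc
        ; *-identity = ∙-identityˡ , λ F n → ≈-trans (∙-comm F (constant 1#) n) (∙-identityˡ F n)
        ; distrib = (λ F G H n → ≈-trans (∙-comm F _ n) (≈-trans (∙-distribʳ F G H n)
                                   (+-cong (∙-comm G F n) (∙-comm H F n))))
                  , ∙-distribʳ
        }
      ; *-comm = ∙-comm
      }
    }

  indeterminate : ℕ → Carrier
  indeterminate zero          = 0#
  indeterminate (suc zero)    = 1#
  indeterminate (suc (suc n)) = 0#

  shift : (ℕ → Carrier) → ℕ → Carrier
  shift F zero    = 0#
  shift F (suc n) = F n

  indeterminate-∙ : ∀ F n → (indeterminate ∙ F) n ≈ shift F n
  indeterminate-∙ F zero    = zeroˡ (F 0)
  indeterminate-∙ F (suc n) =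
    ≈-trans (+-cong (zeroˡ _) (≈-trans (∙-cong tail≈1 (λ _ → ≈-refl) n) (∙-identityˡ F n))) (+-identityˡ _)
    where
    tail≈1 : ∀ k → indeterminate (suc k) ≈ constant 1# k
    tail≈1 zero    = ≈-refl
    tail≈1 (suc k) = ≈-refl

-- The construction is applied twice: series in x whose coefficients are series in y. The carrier is
-- then definitionally `PowerSeries`, with the exponent of x as first index.
module Univariate = Series ℤ.+-*-commutativeRing
module Bivariate  = Series Univariate.seriesRing

open CommutativeRing Bivariate.seriesRing
  using (_≈_; _+_; _*_; -_; _-_; 0#; 1#; +-cong; +-congˡ; +-congʳ; *-congˡ; *-congʳ; *-assoc; *-comm;
         +-assoc; +-comm; distribˡ; distribʳ; zeroˡ; zeroʳ; ring; +-identityˡ; +-identityʳ; *-identityˡ;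
         -‿inverseʳ; setoid; +-commutativeMonoid)
  renaming (refl to ≈-refl; sym to ≈-sym; trans to ≈-trans)
open RingProperties ring using (-‿distribˡ-*)
open CommutativeSemigroupProperties (CommutativeMonoid.commutativeSemigroup +-commutativeMonoid)
  using (interchange; x∙yz≈xz∙y; xy∙z≈x∙zy)

sumℤ : ∀ {n} → (Fin n → ℤ) → ℤ
sumℤ = sumFin ℤ.+-*-semiring

Univariate-∙-sum : ∀ F G n → (F Univariate.∙ G) n ≡ sumℤ {suc n} (λ b → F (toℕ b) ℤ.* G (n ∸ toℕ b))
Univariate-∙-sum F G zero    = sym (ℤ.+-identityʳ _)
Univariate-∙-sum F G (suc n) = cong (λ z → F 0 ℤ.* G (suc n) ℤ.+ z) (Univariate-∙-sum (F ∘ suc) G n)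

-- Moves the equation in `IsRational` into a commutative ring, where the algebra takes place.
⊛-* : ∀ F G → F ⊛ G ≋ F * G
⊛-* F G zero    j = trans (ℤ.+-identityʳ _) (sym (Univariate-∙-sum (F 0) (G 0) j))
⊛-* F G (suc i) j =
  cong₂ ℤ._+_ (sym (Univariate-∙-sum (F 0) (G (suc i)) j)) (⊛-* (F ∘ suc) G i j)

sumℤ-zero : ∀ {n} (t : Fin n → ℤ) → (∀ a → t a ≡ 0ℤ) → sumℤ t ≡ 0ℤ
sumℤ-zero {n} t t≡0 = trans (sum-cong-≋ ℤ.+-*-semiring t≡0) (sum-replicate-zero ℤ.+-*-semiring n)

-- Polynomials and their constant coefficients

Poly : ℤ → PowerSeries → Set
Poly z F = IsPolynomial F × F 0 0 ≡ z

Poly-+ : ∀ {a b F G} → Poly a F → Poly b G → Poly (a ℤ.+ b) (F + G)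
Poly-+ ((M , F≡0) , p) ((N , G≡0) , q) = (M ⊔ N , λ i j big →
  cong₂ ℤ._+_ (F≡0 i j (Sum.map (ℕ.m⊔n≤o⇒m≤o M N) (ℕ.m⊔n≤o⇒m≤o M N) big))
              (G≡0 i j (Sum.map (ℕ.m⊔n≤o⇒n≤o M N) (ℕ.m⊔n≤o⇒n≤o M N) big))) , cong₂ ℤ._+_ p q

Poly-neg : ∀ {a F} → Poly a F → Poly (ℤ.- a) (- F)
Poly-neg ((M , F≡0) , p) = (M , λ i j big → cong ℤ.-_ (F≡0 i j big)) , cong ℤ.-_ p

-- Degree bounds add up: if `i` is at least `M + N`, then for every `a` either `a` is at least `M`
-- or `i ∸ a` is at least `N`, so each product in the convolution has a vanishing factor. The same
-- goes for `j`.
Poly-* : ∀ {a b F G} → Poly a F → Poly b G → Poly (a ℤ.* b) (F * G)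
Poly-* {F = F} {G = G} ((M , F≡0) , p) ((N , G≡0) , q) = (M ℕ.+ N , λ i j big →
  trans (sym (⊛-* F G i j)) (sumℤ-zero {suc i} _ λ a → sumℤ-zero {suc j} _ λ b →
    term i j (toℕ a) (toℕ b) big)) , cong₂ ℤ._*_ p q
  where
  split : ∀ i a → M ℕ.+ N ≤ i → M ≤ a ⊎ N ≤ i ∸ a
  split i a M+N≤i with ℕ.≤-total M a
  ... | inj₁ M≤a = inj₁ M≤a
  ... | inj₂ a≤M = inj₂ (ℕ.m+n≤o⇒m≤o∸n N
    (ℕ.≤-trans (ℕ.+-monoʳ-≤ N a≤M) (ℕ.≤-trans (ℕ.≤-reflexive (ℕ.+-comm N M)) M+N≤i)))

  left : ∀ i j a b → M ≤ a ⊎ M ≤ b → F a b ℤ.* G (i ∸ a) (j ∸ b) ≡ 0ℤ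
  left i j a b big = trans (cong (λ z → z ℤ.* G (i ∸ a) (j ∸ b)) (F≡0 a b big)) (ℤ.*-zeroˡ (G (i ∸ a) (j ∸ b)))

  right : ∀ i j a b → N ≤ i ∸ a ⊎ N ≤ j ∸ b → F a b ℤ.* G (i ∸ a) (j ∸ b) ≡ 0ℤ
  right i j a b big = trans (cong (F a b ℤ.*_) (G≡0 (i ∸ a) (j ∸ b) big)) (ℤ.*-zeroʳ (F a b))

  term : ∀ i j a b → M ℕ.+ N ≤ i ⊎ M ℕ.+ N ≤ j → F a b ℤ.* G (i ∸ a) (j ∸ b) ≡ 0ℤ
  term i j a b (inj₁ big) = Sum.[ left i j a b ∘ inj₁ , right i j a b ∘ inj₁ ] (split i a big)
  term i j a b (inj₂ big) = Sum.[ left i j a b ∘ inj₂ , right i j a b ∘ inj₂ ] (split j b big)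

Poly-0 : Poly 0ℤ 0#
Poly-0 = (0 , λ _ _ _ → refl) , refl

Poly-if : ∀ β {F} → IsPolynomial F → IsPolynomial (if β then F else 0#)
Poly-if true  FP = FP
Poly-if false FP = proj₁ Poly-0

Poly-1 : Poly 1ℤ 1#
Poly-1 = (1 , vanish) , refl
  where
  vanish : ∀ i j → 1 ≤ i ⊎ 1 ≤ j → 1# i j ≡ 0ℤ
  vanish (suc i) j       _ = refl
  vanish zero    (suc j) _ = refl
  vanish zero    zero (inj₁ ())
  vanish zero    zero (inj₂ ())

X Y : PowerSeries
X = Bivariate.indeterminate
Y = Bivariate.constant Univariate.indeterminate

Poly-X : Poly 0ℤ X
Poly-X = (2 , vanish) , refl
  where
  vanish : ∀ i j → 2 ≤ i ⊎ 2 ≤ j → X i j ≡ 0ℤ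
  vanish zero          j             _ = refl
  vanish (suc (suc i)) j             _ = refl
  vanish (suc zero)    (suc j)       _ = refl
  vanish (suc zero)    zero (inj₁ (s≤s ()))
  vanish (suc zero)    zero (inj₂ ())

Poly-Y : Poly 0ℤ Y
Poly-Y = (2 , vanish) , refl
  where
  vanish : ∀ i j → 2 ≤ i ⊎ 2 ≤ j → Y i j ≡ 0ℤ
  vanish (suc i)    j                _ = refl
  vanish zero       zero             _ = refl
  vanish zero       (suc (suc j))    _ = refl
  vanish zero (suc zero) (inj₁ ())
  vanish zero (suc zero) (inj₂ (s≤s ()))

-- Finite linear systems of power series

module _ {I : Set} where

  Σ[_] : List I → (I → PowerSeries) → PowerSeries
  Σ[ []     ] t = 0#
  Σ[ k ∷ ks ] t = t k + Σ[ ks ] t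

  *-distribˡ-Σ : ∀ q ks t → q * Σ[ ks ] t ≈ Σ[ ks ] (λ k → q * t k)
  *-distribˡ-Σ q []       t = zeroʳ q
  *-distribˡ-Σ q (k ∷ ks) t = ≈-trans (distribˡ q (t k) (Σ[ ks ] t)) (+-congˡ {q * t k} (*-distribˡ-Σ q ks t))

  Σ-+ : ∀ ks s t → Σ[ ks ] s + Σ[ ks ] t ≈ Σ[ ks ] (λ k → s k + t k)
  Σ-+ []       s t = +-identityˡ 0#
  Σ-+ (k ∷ ks) s t = ≈-trans (interchange (s k) _ (t k) _) (+-congˡ {s k + t k} (Σ-+ ks s t))

  Σ-cong : ∀ ks {s t} → (∀ k → s k ≈ t k) → Σ[ ks ] s ≈ Σ[ ks ] t
  Σ-cong []       s≈t = ≈-refl {0#}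
  Σ-cong (k ∷ ks) s≈t = +-cong (s≈t k) (Σ-cong ks s≈t)

  -- Gaussian elimination without division: substituting
  -- (D k − M k k) f k = v k + Σ M k j f j into the other equations, multiplied by
  -- D k − M k k, keeps the constant coefficients of D and M at 1 and 0.
  elimination : ∀ (ks : List I) (f : I → PowerSeries) (D v : I → PowerSeries) (M : I → I → PowerSeries) →
    (∀ c → Poly 1ℤ (D c)) → (∀ c → IsPolynomial (v c)) → (∀ c c′ → Poly 0ℤ (M c c′)) →
    (∀ c → D c * f c ≈ v c + Σ[ ks ] (λ k → M c k * f k)) →
    ∀ c → ∃₂ λ q p → Poly 1ℤ q × IsPolynomial p × q * f c ≈ p
  -- The rows run over all indices, also those already eliminated. Once no unknown is left on the
  -- right, every row is solved, and there is no back substitution.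
  elimination []       f D v M D1 vp M0 eq c = D c , v c , D1 c , vp c , ≈-trans (eq c) (+-identityʳ (v c))
  elimination (k ∷ ks) f D v M D1 vp M0 eq =
    elimination ks f (λ c → q * D c) (λ c → q * v c + M c k * v k)
      (λ c c′ → q * M c c′ + M c k * M k c′)
      (λ c → Poly-* q1 (D1 c))
      (λ c → proj₁ (Poly-+ (Poly-* q1 (vp c , refl)) (Poly-* (M0 c k) (vp k , refl))))
      (λ c c′ → Poly-+ (Poly-* q1 (M0 c c′)) (Poly-* (M0 c k) (M0 k c′)))
      row
    where
    open SetoidReasoning setoid
    q : PowerSeries
    q = D k - M k k

    q1 : Poly 1ℤ q
    q1 = Poly-+ (D1 k) (Poly-neg (M0 k k))

    S : I → PowerSeries
    S c = Σ[ ks ] (λ j → M c j * f j)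

    swap* : ∀ a b c → a * (b * c) ≈ b * (a * c)
    swap* a b c = ≈-trans (≈-sym (*-assoc a b c)) (≈-trans (*-congʳ {c} (*-comm a b)) (*-assoc b a c))

    pivot : q * f k ≈ v k + S k
    pivot = begin
      (D k - M k k) * f k                        ≈⟨ distribʳ (f k) (D k) (- M k k) ⟩
      D k * f k + - M k k * f k                  ≈⟨ +-congʳ { - M k k * f k} (eq k) ⟩
      v k + (M k k * f k + S k) + - M k k * f k  ≈⟨ +-congʳ { - M k k * f k} (x∙yz≈xz∙y (v k) (M k k * f k) (S k)) ⟩
      v k + S k + M k k * f k + - M k k * f k    ≈⟨ +-assoc (v k + S k) (M k k * f k) (- M k k * f k) ⟩
      v k + S k + (M k k * f k + - M k k * f k)  ≈⟨ +-congˡ {v k + S k} (distribʳ (f k) (M k k) (- M k k)) ⟨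
      v k + S k + (M k k + - M k k) * f k        ≈⟨ +-congˡ {v k + S k} (*-congʳ {f k} (-‿inverseʳ (M k k))) ⟩
      v k + S k + 0# * f k                       ≈⟨ +-congˡ {v k + S k} (zeroˡ (f k)) ⟩
      v k + S k + 0#                             ≈⟨ +-identityʳ (v k + S k) ⟩
      v k + S k                                  ∎

    substituted : ∀ c → q * (M c k * f k) ≈ M c k * v k + M c k * S k
    substituted c = begin
      q * (M c k * f k)          ≈⟨ swap* q (M c k) (f k) ⟩
      M c k * (q * f k)          ≈⟨ *-congˡ {M c k} pivot ⟩
      M c k * (v k + S k)        ≈⟨ distribˡ (M c k) (v k) (S k) ⟩
      M c k * v k + M c k * S k  ∎

    combined : ∀ c → q * S c + M c k * S k ≈ Σ[ ks ] (λ j → (q * M c j + M c k * M k j) * f j)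
    combined c = begin
      q * S c + M c k * S k
        ≈⟨ +-cong (*-distribˡ-Σ q ks (λ j → M c j * f j)) (*-distribˡ-Σ (M c k) ks (λ j → M k j * f j)) ⟩
      Σ[ ks ] (λ j → q * (M c j * f j)) + Σ[ ks ] (λ j → M c k * (M k j * f j))
        ≈⟨ Σ-+ ks (λ j → q * (M c j * f j)) (λ j → M c k * (M k j * f j)) ⟩
      Σ[ ks ] (λ j → q * (M c j * f j) + M c k * (M k j * f j))
        ≈⟨ Σ-cong ks (λ j → +-cong (*-assoc q (M c j) (f j)) (*-assoc (M c k) (M k j) (f j))) ⟨
      Σ[ ks ] (λ j → q * M c j * f j + M c k * M k j * f j)
        ≈⟨ Σ-cong ks (λ j → distribʳ (f j) (q * M c j) (M c k * M k j)) ⟨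
      Σ[ ks ] (λ j → (q * M c j + M c k * M k j) * f j) ∎

    row : ∀ c → (q * D c) * f c ≈
          (q * v c + M c k * v k) + Σ[ ks ] (λ j → (q * M c j + M c k * M k j) * f j)
    row c = begin
      q * D c * f c
        ≈⟨ *-assoc q (D c) (f c) ⟩
      q * (D c * f c)
        ≈⟨ *-congˡ {q} (eq c) ⟩
      q * (v c + (M c k * f k + S c))
        ≈⟨ distribˡ q (v c) (M c k * f k + S c) ⟩
      q * v c + q * (M c k * f k + S c)
        ≈⟨ +-congˡ {q * v c} (distribˡ q (M c k * f k) (S c)) ⟩
      q * v c + (q * (M c k * f k) + q * S c)
        ≈⟨ +-congˡ {q * v c} (+-congʳ {q * S c} (substituted c)) ⟩
      q * v c + (M c k * v k + M c k * S k + q * S c)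
        ≈⟨ +-congˡ {q * v c} (xy∙z≈x∙zy (M c k * v k) (M c k * S k) (q * S c)) ⟩
      q * v c + (M c k * v k + (q * S c + M c k * S k))
        ≈⟨ +-assoc (q * v c) (M c k * v k) (q * S c + M c k * S k) ⟨
      q * v c + M c k * v k + (q * S c + M c k * S k)
        ≈⟨ +-congˡ {q * v c + M c k * v k} (combined c) ⟩
      q * v c + M c k * v k + Σ[ ks ] (λ j → (q * M c j + M c k * M k j) * f j) ∎

-- Multiplication by monomials

Y-* : ∀ F i j → (Y * F) i j ≡ Univariate.shift (F i) j
Y-* F i j = trans (Bivariate.constant-∙ Univariate.indeterminate F i j) (Univariate.indeterminate-∙ (F i) j)

shiftX : ℕ → PowerSeries → PowerSeries
shiftX zero    F         = F
shiftX (suc a) F zero    = λ _ → 0ℤ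
shiftX (suc a) F (suc i) = shiftX a F i

X^ : ℕ → PowerSeries
X^ zero    = 1#
X^ (suc a) = X * X^ a

X^-* : ∀ a F → X^ a * F ≈ shiftX a F
X^-* zero    F     = *-identityˡ F
X^-* (suc a) F i j = trans (*-assoc X (X^ a) F i j)
  (trans (Bivariate.indeterminate-∙ (X^ a * F) i j) (unfold i))
  where
  unfold : ∀ i → Bivariate.shift (X^ a * F) i j ≡ shiftX (suc a) F i j
  unfold zero    = refl
  unfold (suc i) = X^-* a F i j

Poly-X^ : ∀ a → IsPolynomial (X^ a)
Poly-X^ zero    = proj₁ Poly-1
Poly-X^ (suc a) = proj₁ (Poly-* Poly-X (Poly-X^ a , refl))

-- The denominator is q times XY. Its coefficient at (1, 1) is the constant coefficient of q, which
-- is 1, so it is not zero.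
rational-from-shift : ∀ {q p} f F → Poly 1ℤ q → IsPolynomial p → q * F ≈ p →
  X * (Y * f) ≈ (1# - Y) * F → IsRational f
rational-from-shift {q} {p} f F q1 pp qF≈p shift =
  (1# - Y) * p , q * (X * Y) ,
  proj₁ (Poly-* (Poly-+ Poly-1 (Poly-neg Poly-Y)) (pp , refl)) ,
  proj₁ (Poly-* q1 (Poly-* Poly-X Poly-Y)) ,
  (1 , 1 , λ qxy≡0 → 1≢0 (trans (sym (proj₂ q1)) (trans (sym (coefficient q)) qxy≡0))) ,
  λ i j → trans (⊛-* (q * (X * Y)) f i j) (equation i j)
  where
  open SetoidReasoning setoid

  1≢0 : 1ℤ ≢ 0ℤ
  1≢0 ()

  coefficient : ∀ q → (q * (X * Y)) 1 1 ≡ q 0 0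
  coefficient q = trans (≈-trans (≈-sym (*-assoc q X Y)) (*-comm (q * X) Y) 1 1)
    (trans (Y-* (q * X) 1 1) (trans (*-comm q X 1 0) (Bivariate.indeterminate-∙ q 1 0)))

  equation : q * (X * Y) * f ≈ (1# - Y) * p
  equation = begin
    q * (X * Y) * f       ≈⟨ *-assoc q (X * Y) f ⟩
    q * (X * Y * f)       ≈⟨ *-congˡ {q} (≈-trans (*-assoc X Y f) shift) ⟩
    q * ((1# - Y) * F)    ≈⟨ *-assoc q (1# - Y) F ⟨
    q * (1# - Y) * F      ≈⟨ *-congʳ {F} (*-comm q (1# - Y)) ⟩
    (1# - Y) * q * F      ≈⟨ *-assoc (1# - Y) q F ⟩
    (1# - Y) * (q * F)    ≈⟨ *-congˡ {1# - Y} qF≈p ⟩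
    (1# - Y) * p          ∎

-- Counting

private
  variable
    A B C : Set

-- Pigeonhole by induction on `xs`: the head is cut out of `ys`, and uniqueness keeps the other
-- entries of `xs` inside what is left.
Unique∧⊆⇒length≤ : ∀ {xs ys : List A} → Unique xs → xs ⊆ ys → length xs ≤ length ys
Unique∧⊆⇒length≤ []                      sub = z≤n
Unique∧⊆⇒length≤ {xs = x ∷ xs} (x≢ ∷ u) sub with ∈-∃++ (sub (here refl))
... | as , bs , refl = ℕ.≤-trans (s≤s (Unique∧⊆⇒length≤ u sub′)) (ℕ.≤-reflexive lengths)
  where
  sub′ : xs ⊆ as ++ bs
  sub′ {z} z∈ with ∈-++⁻ as (sub (there z∈))
  ... | inj₁ z∈as         = ∈-++⁺ˡ z∈as
  ... | inj₂ (here refl)  = ⊥-elim (All.lookup x≢ z∈ refl)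
  ... | inj₂ (there z∈bs) = ∈-++⁺ʳ as z∈bs

  lengths : suc (length (as ++ bs)) ≡ length (as ++ x ∷ bs)
  lengths = trans (cong suc (length-++ as)) (trans (sym (ℕ.+-suc (length as) _)) (sym (length-++ as)))

-- A relation, because a predicate has no cardinality to compute. By `count-≡` the number is well
-- defined.
Count : U.Pred A 0ℓ → ℕ → Set
Count P k = ∃[ e ] Enumeration.cardinality {P = P} e ≡ k

count-≡ : ∀ {P Q : U.Pred A 0ℓ} {a b} → Count P a → Count Q b → (∀ x → P x ⇔ Q x) → a ≡ b
count-≡ (e , refl) (e′ , refl) eq = ℕ.≤-antisym
  (Unique∧⊆⇒length≤ (E.unique e) λ {x} x∈ → from (E.exact e′ x) (to (eq x) (to (E.exact e x) x∈)))
  (Unique∧⊆⇒length≤ (E.unique e′) λ {x} x∈ → from (E.exact e x) (from (eq x) (to (E.exact e′ x) x∈)))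
  where module E = Enumeration

count-⇔ : ∀ {P Q : U.Pred A 0ℓ} {k} → (∀ x → P x → Q x) → (∀ x → Q x → P x) → Count P k → Count Q k
count-⇔ P⇒Q Q⇒P (e , eq) = record
  { elements = elements
  ; unique   = unique
  ; exact    = λ x → mk⇔ (P⇒Q x ∘ to (exact x)) (from (exact x) ∘ Q⇒P x)
  } , eq
  where open Enumeration e

count-∅ : ∀ {P : U.Pred A 0ℓ} → (∀ x → ¬ P x) → Count P 0
count-∅ ¬P = record
  { elements = [] ; unique = [] ; exact = λ x → mk⇔ (λ ()) (⊥-elim ∘ ¬P x) } , refl

count-singleton : ∀ {P : U.Pred A 0ℓ} a → P a → (∀ x → P x → x ≡ a) → Count P 1
count-singleton a Pa only = record
  { elements = [ a ]
  ; unique   = [] ∷ []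
  ; exact    = λ x → mk⇔ (λ { (here refl) → Pa }) (here ∘ only x)
  } , refl

count-if : ∀ {D : Set} {P : U.Pred A 0ℓ} {k} (d : Dec D) → (D → Count P k) → (¬ D → Count P 0) →
           Count P (if does d then k else 0)
count-if (yes d) yes-count _        = yes-count d
count-if (no ¬d) _         no-count = no-count ¬d

count-⊎ : ∀ {P Q : U.Pred A 0ℓ} {a b} → Count P a → Count Q b → (∀ x → P x → ¬ Q x) →
          Count (λ x → P x ⊎ Q x) (a ℕ.+ b)
count-⊎ (e , refl) (e′ , refl) disjoint = record
  { elements = E.elements e ++ E.elements e′
  ; unique   = Unique.++⁺ (E.unique e) (E.unique e′)
                 λ {x} (x∈ , x∈′) → disjoint x (to (E.exact e x) x∈) (to (E.exact e′ x) x∈′)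
  ; exact    = λ x → mk⇔ (Sum.map (to (E.exact e x)) (to (E.exact e′ x)) ∘ ∈-++⁻ (E.elements e))
                 Sum.[ ∈-++⁺ˡ ∘ from (E.exact e x) , ∈-++⁺ʳ (E.elements e) ∘ from (E.exact e′ x) ]
  } , length-++ (E.elements e)
  where module E = Enumeration

-- `R` is a relation and not a function because it will be instantiated with gluing, which is
-- defined only for pieces that fit together.
count-image : ∀ {P : U.Pred A 0ℓ} {k} (R : A → B → Set) → Count P k →
              (∀ a → P a → ∃ (R a)) →
              (∀ {a b b′} → R a b → R a b′ → b ≡ b′) →
              (∀ {a a′ b} → R a b → R a′ b → a ≡ a′) →
              Count (λ b → ∃[ a ] P a × R a b) k
count-image {A = A} {B = B} {P = P} R (e , refl) total functional injective =
  record
    { elements = proj₁ result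
    ; unique   = proj₁ (proj₂ (proj₂ result))
    ; exact    = λ b → mk⇔
        (λ b∈ → let a , a∈ , Rab = to (proj₂ (proj₂ (proj₂ result)) b) b∈ in a , to (exact a) a∈ , Rab)
        (λ (a , Pa , Rab) → from (proj₂ (proj₂ (proj₂ result)) b) (a , from (exact a) Pa , Rab))
    } , proj₁ (proj₂ result)
  where
  open Enumeration e

  image : ∀ {xs} → Unique xs → All (λ a → ∃ (R a)) xs →
          ∃[ ys ] length ys ≡ length xs × Unique ys × (∀ b → b ∈ ys ⇔ (∃[ a ] a ∈ xs × R a b))
  image []        []               = [] , refl , [] , λ b → mk⇔ (λ ()) (λ { (_ , () , _) })
  image (x≢ ∷ u) ((b , Rxb) ∷ Rs) with image u Rs
  ... | ys , len , uys , eq =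
    b ∷ ys , cong suc len ,
    All.¬Any⇒All¬ ys (λ b∈ → let a , a∈ , Rab = to (eq b) b∈ in All.lookup x≢ a∈ (injective Rxb Rab)) ∷ uys ,
    λ b′ → mk⇔
      (λ { (here refl) → _ , here refl , Rxb
         ; (there b∈) → let a , a∈ , Rab = to (eq b′) b∈ in a , there a∈ , Rab })
      (λ { (_ , here refl , Rab) → here (functional Rab Rxb)
         ; (a , there a∈ , Rab)  → there (from (eq b′) (a , a∈ , Rab)) })

  result = image unique (All.tabulate (λ {a} a∈ → total a (to (exact a) a∈)))

count-∃∈ : ∀ {P : C → U.Pred A 0ℓ} {k : C → ℕ} {cs} → Unique cs →
           (∀ {c} → c ∈ cs → Count (P c) (k c)) →
           (∀ {c c′ x} → P c x → P c′ x → c ≡ c′) →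
           Count (λ x → ∃[ c ] c ∈ cs × P c x) (sum (map k cs))
count-∃∈ [] _ _ = count-∅ λ { _ (_ , () , _) }
count-∃∈ (c≢ ∷ u) counts disjoint = count-⇔
  (λ _ → Sum.[ (λ Pcx → _ , here refl , Pcx) , (λ (c , c∈ , Pcx) → c , there c∈ , Pcx) ])
  (λ { _ (_ , here refl , Pcx) → inj₁ Pcx ; _ (c , there c∈ , Pcx) → inj₂ (c , c∈ , Pcx) })
  (count-⊎ (counts (here refl)) (count-∃∈ u (counts ∘ there) disjoint)
    (λ _ Pcx (_ , c′∈ , Pc′x) → All.lookup c≢ c′∈ (disjoint Pcx Pc′x)))

-- The coefficients of x^a times the series of `f`. Below `a` they are 0, where truncated
-- subtraction would give `f 0`.
shiftℕ : ℕ → (ℕ → ℕ) → ℕ → ℕ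
shiftℕ zero    f n       = f n
shiftℕ (suc a) f zero    = 0
shiftℕ (suc a) f (suc n) = shiftℕ a f n

count-shiftℕ : ∀ {P : ℕ → U.Pred A 0ℓ} {f} → (∀ m → Count (P m) (f m)) → ∀ a n →
               Count (λ x → ∃[ m ] a ℕ.+ m ≡ n × P m x) (shiftℕ a f n)
count-shiftℕ counts zero n =
  count-⇔ (λ _ Pnx → n , refl , Pnx) (λ { _ (_ , refl , Pnx) → Pnx }) (counts n)
count-shiftℕ counts (suc a) zero    = count-∅ λ { _ (_ , () , _) }
count-shiftℕ counts (suc a) (suc n) =
  count-⇔ (λ _ (m , eq , Pmx) → m , cong suc eq , Pmx) (λ _ (m , eq , Pmx) → m , ℕ.suc-injective eq , Pmx)
    (count-shiftℕ counts a n)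

words≤ : List A → ℕ → List (List A)
words≤ as zero    = [ [] ]
words≤ as (suc n) = [] ∷ cartesianProductWith _∷_ as (words≤ as n)

words≤-unique : ∀ {as : List A} → Unique as → ∀ n → Unique (words≤ as n)
words≤-unique as! zero    = [] ∷ []
words≤-unique {as = as} as! (suc n) =
  All.¬Any⇒All¬ _ nonempty ∷ Unique.cartesianProductWith⁺ _∷_ ∷-injective as! (words≤-unique as! n)
  where
  nonempty : ¬ [] ∈ cartesianProductWith _∷_ as (words≤ as n)
  nonempty []∈ with ∈-cartesianProductWith⁻ _∷_ as (words≤ as n) []∈
  ... | _ , _ , _ , _ , ()

∈-words≤ : ∀ {as} {ws : List A} {n} → All (_∈ as) ws → length ws ≤ n → ws ∈ words≤ as n
∈-words≤ {n = zero}  []         z≤n      = here refl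
∈-words≤ {n = suc n} []         z≤n      = here refl
∈-words≤             (w∈ ∷ ws∈) (s≤s le) = there (∈-cartesianProductWith⁺ _∷_ w∈ (∈-words≤ ws∈ le))

-- Cutting a walk along a column

adjacent-origin : ∀ a b → suc a ^ 2 ℕ.+ b ^ 2 ≡ 1 → a ≡ 0 × b ≡ 0
adjacent-origin zero    zero    eq = refl , refl
adjacent-origin zero    (suc b) ()
adjacent-origin (suc a) b       ()

module _ {h : ℕ} where

  adjacent-across : ∀ {x} {y y′ : Fin h} → Adjacent (0 , y) (suc x , y′) → x ≡ 0 × y ≡ y′
  adjacent-across {x} {y} {y′} adj with adjacent-origin x ∣ toℕ y - toℕ y′ ∣ adj
  ... | x≡0 , d≡0 = x≡0 , Fin.toℕ-injective (ℕ.∣m-n∣≡0⇒m≡n d≡0)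

  adjacent-across′ : ∀ {x} {y y′ : Fin h} → Adjacent (suc x , y) (0 , y′) → x ≡ 0 × y ≡ y′
  adjacent-across′ {x} {y} {y′} adj with adjacent-origin x ∣ toℕ y - toℕ y′ ∣ adj
  ... | x≡0 , d≡0 = x≡0 , Fin.toℕ-injective (ℕ.∣m-n∣≡0⇒m≡n d≡0)

  across : ∀ (y : Fin h) → Adjacent (0 , y) (1 , y)
  across y rewrite ℕ.∣n-n∣≡0 (toℕ y) = refl

  across′ : ∀ (y : Fin h) → Adjacent (1 , y) (0 , y)
  across′ y rewrite ℕ.∣n-n∣≡0 (toℕ y) = refl

-- Unlike `last`, this computes from the front, in step with the recursion of `Out` and `In`.
end : {A : Set} → A → List A → A
end a []       = a
end a (b ∷ bs) = end b bs

module _ (h : ℕ) where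

  -- A walk seen from some column on, which is renumbered 0: nothing stands for a
  -- maximal excursion to the left of it.
  Item : Set
  Item = Maybe (Vertex h)

  -- The trace of a walk on a single column; L and R stand for excursions to the
  -- left and to the right.
  data Cell : Set where
    L R : Cell
    at  : Fin h → Cell

module _ {h : ℕ} where

  -- Marks are never adjacent: excursions are maximal, and passing from one side to the other uses a
  -- vertex of the column.
  data _—_ : Rel (Cell h) 0ℓ where
    L-at  : ∀ {y} → L — at y
    at-L  : ∀ {y} → at y — L
    R-at  : ∀ {y} → R — at y
    at-R  : ∀ {y} → at y — R
    at-at : ∀ {y y′} → Adjacent {h} (0 , y) (0 , y′) → at y — at y′

  data Step : Rel (Item h) 0ℓ where
    enter : ∀ {y} → Step nothing (just (0 , y))
    leave : ∀ {y} → Step (just (0 , y)) nothing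
    move  : ∀ {u v} → Adjacent u v → Step (just u) (just v)

  heights : List (Cell h) → List (Fin h)
  heights []         = []
  heights (L ∷ c)    = heights c
  heights (R ∷ c)    = heights c
  heights (at y ∷ c) = y ∷ heights c

  -- The direction of a crossing is not recorded: crossings in and out alternate, and the starting
  -- position tells which comes first.
  emit : Cell h → Cell h → List (Fin h) → List (Fin h)
  emit L      (at y) ys = y ∷ ys
  emit (at y) L      ys = y ∷ ys
  emit _      _      ys = ys

  -- Crossings to and from the left; composed with mirror, to and from the right.
  crossings : {A : Set} → (A → Cell h) → A → List A → List (Fin h)
  crossings k a []       = []
  crossings k a (b ∷ bs) = emit (k a) (k b) (crossings k b bs)

  mirror : Cell h → Cell h
  mirror L      = R
  mirror R      = L
  mirror (at y) = at y

  kind : Item h → Cell h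
  kind nothing            = L
  kind (just (zero  , y)) = at y
  kind (just (suc x , y)) = R

  right : Vertex h → Vertex h
  right (x , y) = suc x , y

  cell : Maybe (Fin h) → Cell h
  cell nothing  = L
  cell (just y) = at y

  item : Maybe (Fin h) → Item h
  item nothing  = nothing
  item (just y) = just (0 , y)

  -- Out p c w′ w says that w is glued from its trace c on column 0 and the part w′
  -- from column 1 on, when the previous position is p, in column 0 or to the left
  -- of it; In v c w′ w says the same when the previous position is right v.
  data Out : Maybe (Fin h) → List (Cell h) → List (Item h) → List (Item h) → Set
  data In  : Vertex h      → List (Cell h) → List (Item h) → List (Item h) → Set

  data Out where
    done  : ∀ {p} → Out p [] [] []
    left  : ∀ {y c w′ w} → Out nothing c w′ w → Out (just y) (L ∷ c) w′ (nothing ∷ w)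
    stay  : ∀ {p y c w′ w} → cell p — at y → Out (just y) c w′ w → Out p (at y ∷ c) w′ (just (0 , y) ∷ w)
    cross : ∀ {y c w′ w} → In (0 , y) c w′ w →
            Out (just y) (R ∷ c) (just (0 , y) ∷ w′) (just (1 , y) ∷ w)

  data In where
    done : ∀ {v} → In v [] [] []
    step : ∀ {u v c w′ w} → Adjacent u v → In v c w′ w → In u c (just v ∷ w′) (just (right v) ∷ w)
    back : ∀ {y c w′ w} → Out (just y) c w′ w →
           In (0 , y) (at y ∷ c) (nothing ∷ w′) (just (0 , y) ∷ w)

  split-out : ∀ p {w} → Linked Step (item p ∷ w) → ∃₂ λ c w′ → Out p c w′ w
  split-in  : ∀ v {w} → Linked Step (just (right v) ∷ w) → ∃₂ λ c w′ → In v c w′ w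

  split-out p [-] = [] , [] , done
  split-out nothing  (enter {y} ∷ s) with split-out (just y) s
  ... | c , w′ , o = at y ∷ c , w′ , stay L-at o
  split-out (just y) (leave ∷ s) with split-out nothing s
  ... | c , w′ , o = L ∷ c , w′ , left o
  split-out (just y) (move {v = zero , y′} adj ∷ s) with split-out (just y′) s
  ... | c , w′ , o = at y′ ∷ c , w′ , stay (at-at adj) o
  split-out (just y) (move {v = suc x , y′} adj ∷ s) with adjacent-across {x = x} {y} {y′} adj
  ... | refl , refl with split-in (0 , y) s
  ... | c , w′ , i = R ∷ c , just (0 , y) ∷ w′ , cross i

  split-in v [-] = [] , [] , done
  split-in v (move {v = suc x , y} adj ∷ s) with split-in (x , y) s
  ... | c , w′ , i = c , just (x , y) ∷ w′ , step adj i
  split-in (x , y) (move {v = zero , y′} adj ∷ s) with adjacent-across′ {x = x} {y} {y′} adj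
  ... | refl , refl with split-out (just y) s
  ... | c , w′ , o = at y ∷ c , nothing ∷ w′ , back o

  -- The trace drives the walk up to column 0, and `w′` drives it beyond. Control passes at each
  -- crossing, where both sides consume the same entry of the common list of crossings.
  merge-out : ∀ p {c w′} → Linked _—_ (cell p ∷ c) → Linked Step (nothing ∷ w′) →
              crossings mirror (cell p) c ≡ crossings kind nothing w′ → ∃ (Out p c w′)
  merge-in  : ∀ v {c w′} → Linked _—_ (R ∷ c) → Linked Step (just v ∷ w′) →
              crossings mirror R c ≡ crossings kind (just v) w′ → ∃ (In v c w′)

  merge-out p [-] [-] eq = [] , done
  -- The trace is exhausted but `w′` enters once more, so one list of crossings is empty and the
  -- other is not.
  merge-out nothing  [-] (enter ∷ _) ()
  merge-out (just _) [-] (enter ∷ _) ()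
  merge-out nothing  (L-at {y} ∷ l) s eq with merge-out (just y) l s eq
  ... | w , o = just (0 , y) ∷ w , stay L-at o
  merge-out (just y) (at-L ∷ l) s eq with merge-out nothing l s eq
  ... | w , o = nothing ∷ w , left o
  merge-out (just y) (at-at {y′ = y′} adj ∷ l) s eq with merge-out (just y′) l s eq
  ... | w , o = just (0 , y′) ∷ w , stay (at-at adj) o
  merge-out (just y) (at-R ∷ l) (enter ∷ s) eq with ∷-injective eq
  ... | refl , eq′ with merge-in (0 , y) l s eq′
  ... | w , i = just (1 , y) ∷ w , cross i

  merge-in v [-] [-] eq = [] , done
  merge-in (zero  , _) (R-at ∷ _) [-] ()
  merge-in (suc _ , _) (R-at ∷ _) [-] ()
  -- The three cases are alike; they are separated only to make `emit` reduce.
  merge-in (zero  , _) l (move {v = zero , _} adj ∷ s)  eq with merge-in _ l s eq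
  ... | w , i = _ , step adj i
  merge-in (zero  , _) l (move {v = suc _ , _} adj ∷ s) eq with merge-in _ l s eq
  ... | w , i = _ , step adj i
  merge-in (suc _ , _) l (move adj ∷ s) eq with merge-in _ l s eq
  ... | w , i = _ , step adj i
  merge-in (zero , y) (R-at ∷ l) (leave ∷ s) eq with ∷-injective eq
  ... | refl , eq′ with merge-out (just y) l s eq′
  ... | w , o = just (0 , y) ∷ w , back o

  out-linked : ∀ {p c w′ w} → Out p c w′ w → Linked Step (item p ∷ w)
  in-linked  : ∀ {v c w′ w} → In v c w′ w → Linked Step (just (right v) ∷ w)
  out-linked done      = [-]
  out-linked (left o)  = leave ∷ out-linked o
  out-linked {p = nothing} (stay L-at o)        = enter ∷ out-linked o
  out-linked {p = just _}  (stay (at-at adj) o) = move adj ∷ out-linked o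
  out-linked {p = just y} (cross i) = move (across y) ∷ in-linked i
  in-linked done         = [-]
  in-linked (step adj i) = move adj ∷ in-linked i
  in-linked {v = _ , y} (back o) = move (across′ y) ∷ out-linked o

  out-linkedˡ : ∀ {p c w′ w} → Out p c w′ w → Linked _—_ (cell p ∷ c)
  in-linkedˡ  : ∀ {v c w′ w} → In v c w′ w → Linked _—_ (R ∷ c)
  out-linkedˡ done       = [-]
  out-linkedˡ (left o)   = at-L ∷ out-linkedˡ o
  out-linkedˡ (stay s o) = s ∷ out-linkedˡ o
  out-linkedˡ (cross i)  = at-R ∷ in-linkedˡ i
  in-linkedˡ done       = [-]
  in-linkedˡ (step _ i) = in-linkedˡ i
  in-linkedˡ (back o)   = R-at ∷ out-linkedˡ o

  out-linkedʳ : ∀ {p c w′ w} → Out p c w′ w → Linked Step (nothing ∷ w′)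
  in-linkedʳ  : ∀ {v c w′ w} → In v c w′ w → Linked Step (just v ∷ w′)
  out-linkedʳ done       = [-]
  out-linkedʳ (left o)   = out-linkedʳ o
  out-linkedʳ (stay _ o) = out-linkedʳ o
  out-linkedʳ (cross i)  = enter ∷ in-linkedʳ i
  in-linkedʳ done         = [-]
  in-linkedʳ (step adj i) = move adj ∷ in-linkedʳ i
  in-linkedʳ (back o)     = leave ∷ out-linkedʳ o

  out-crossings : ∀ {p c w′ w} → Out p c w′ w → crossings mirror (cell p) c ≡ crossings kind nothing w′
  in-crossings  : ∀ {v c w′ w} → In v c w′ w → crossings mirror R c ≡ crossings kind (just v) w′
  out-crossings done     = refl
  out-crossings (left o) = out-crossings o
  out-crossings {nothing} (stay _ o) = out-crossings o
  out-crossings {just _}  (stay _ o) = out-crossings o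
  out-crossings {just y} (cross i)  = cong (y ∷_) (in-crossings i)
  in-crossings done = refl
  in-crossings {zero  , _} (step {v = zero , _} _ i)  = in-crossings i
  in-crossings {zero  , _} (step {v = suc _ , _} _ i) = in-crossings i
  in-crossings {suc _ , _} (step _ i) = in-crossings i
  in-crossings {zero , y} (back o) = cong (y ∷_) (out-crossings o)

  out-crossingsᴸ : ∀ {p c w′ w} → Out p c w′ w → crossings id (cell p) c ≡ crossings kind (item p) w
  in-crossingsᴸ  : ∀ {v c w′ w} → In v c w′ w → crossings id R c ≡ crossings kind (just (right v)) w
  out-crossingsᴸ done = refl
  out-crossingsᴸ {just y}  (left o) = cong (y ∷_) (out-crossingsᴸ o)
  out-crossingsᴸ {nothing} (stay {y = y} _ o) = cong (y ∷_) (out-crossingsᴸ o)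
  out-crossingsᴸ {just _}  (stay _ o) = out-crossingsᴸ o
  out-crossingsᴸ {just y}  (cross i)  = in-crossingsᴸ i
  in-crossingsᴸ done       = refl
  in-crossingsᴸ (step _ i) = in-crossingsᴸ i
  in-crossingsᴸ (back o)   = out-crossingsᴸ o

  -- In `Out` the head of the trace determines the constructor, in `In` the head of `w′` does.
  out-functional : ∀ {p c w′ w₁ w₂} → Out p c w′ w₁ → Out p c w′ w₂ → w₁ ≡ w₂
  in-functional  : ∀ {v c w′ w₁ w₂} → In v c w′ w₁ → In v c w′ w₂ → w₁ ≡ w₂
  out-functional done       done        = refl
  out-functional (left o)   (left o′)   = cong (_ ∷_) (out-functional o o′)
  out-functional (stay _ o) (stay _ o′) = cong (_ ∷_) (out-functional o o′)
  out-functional (cross i)  (cross i′)  = cong (_ ∷_) (in-functional i i′)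
  in-functional done       done        = refl
  in-functional (step _ i) (step _ i′) = cong (_ ∷_) (in-functional i i′)
  in-functional (back o)   (back o′)   = cong (_ ∷_) (out-functional o o′)

  -- The column of the first item of `w`, or its being `nothing`, determines the constructor. With
  -- functionality, counting pairs of trace and rest amounts to counting walks.
  out-injective : ∀ {p c₁ c₂ w₁ w₂ w} → Out p c₁ w₁ w → Out p c₂ w₂ w → c₁ ≡ c₂ × w₁ ≡ w₂
  in-injective  : ∀ {v c₁ c₂ w₁ w₂ w} → In v c₁ w₁ w → In v c₂ w₂ w → c₁ ≡ c₂ × w₁ ≡ w₂
  out-injective done done = refl , refl
  out-injective (left o) (left o′) with out-injective o o′
  ... | refl , refl = refl , refl
  out-injective (stay _ o) (stay _ o′) with out-injective o o′
  ... | refl , refl = refl , refl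
  out-injective (cross i) (cross i′) with in-injective i i′
  ... | refl , refl = refl , refl
  in-injective done done = refl , refl
  in-injective (step _ i) (step _ i′) with in-injective i i′
  ... | refl , refl = refl , refl
  in-injective (back o) (back o′) with out-injective o o′
  ... | refl , refl = refl , refl

  column₀ : List (Cell h) → List (Vertex h)
  column₀ c = map (0 ,_) (heights c)

  -- Only a permutation, because the walk interleaves its columns. It suffices to transfer
  -- membership, uniqueness, size and width.
  out-vertices : ∀ {p c w′ w} → Out p c w′ w → catMaybes w ↭ column₀ c ++ map right (catMaybes w′)
  in-vertices  : ∀ {v c w′ w} → In v c w′ w → catMaybes w ↭ column₀ c ++ map right (catMaybes w′)
  out-vertices done       = ↭-refl
  out-vertices (left o)   = out-vertices o
  out-vertices (stay _ o) = prep _ (out-vertices o)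
  out-vertices (cross {c = c} i) = ↭-trans (prep _ (in-vertices i)) (↭-sym (↭-shift _ (column₀ c) _))
  in-vertices done       = ↭-refl
  in-vertices (step {c = c} _ i) = ↭-trans (prep _ (in-vertices i)) (↭-sym (↭-shift _ (column₀ c) _))
  in-vertices (back o)   = prep _ (out-vertices o)

  -- The ends of the trace, of the part beyond and of the glued walk: either the walk ends in or to
  -- the left of column 0, and the part beyond ends in an excursion, or all three see it end beyond.
  data Ends : Cell h → Item h → Item h → Set where
    column : ∀ p → Ends (cell p) nothing (item p)
    beyond : ∀ v → Ends R (just v) (just (right v))

  out-ends : ∀ {p c w′ w} → Out p c w′ w → Ends (end (cell p) c) (end nothing w′) (end (item p) w)
  in-ends  : ∀ {v c w′ w} → In v c w′ w → Ends (end R c) (end (just v) w′) (end (just (right v)) w)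
  out-ends done       = column _
  out-ends (left o)   = out-ends o
  out-ends (stay _ o) = out-ends o
  out-ends (cross i)  = in-ends i
  in-ends done       = beyond _
  in-ends (step _ i) = in-ends i
  in-ends (back o)   = out-ends o

-- The transfer matrix

Unique-++⁻ : ∀ {A : Set} (xs : List A) {ys} → Unique (xs ++ ys) → Unique xs × Unique ys
Unique-++⁻ []       u        = [] , u
Unique-++⁻ (x ∷ xs) (x≢ ∷ u) with Unique-++⁻ xs u
... | uxs , uys = All.++⁻ˡ xs x≢ ∷ uxs , uys

module _ {h : ℕ} where

  _≟ᶜ_ : DecidableEquality (Cell h)
  L    ≟ᶜ L     = yes refl
  L    ≟ᶜ R     = no λ ()
  L    ≟ᶜ at _  = no λ ()
  R    ≟ᶜ L     = no λ ()
  R    ≟ᶜ R     = yes refl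
  R    ≟ᶜ at _  = no λ ()
  at _ ≟ᶜ L     = no λ ()
  at _ ≟ᶜ R     = no λ ()
  at y ≟ᶜ at y′ = map′ (cong at) (λ { refl → refl }) (y Fin.≟ y′)

  _—?_ : Decidable (_—_ {h})
  L    —? L     = no λ ()
  L    —? R     = no λ ()
  L    —? at _  = yes L-at
  R    —? L     = no λ ()
  R    —? R     = no λ ()
  R    —? at _  = yes R-at
  at _ —? L     = yes at-L
  at _ —? R     = yes at-R
  at y —? at y′ = map′ at-at (λ { (at-at adj) → adj }) (_ ℕ.≟ 1)

  open DecMembership (Fin._≟_ {h}) using (_∈?_)
  open DecUnique (Fin._≟_ {h}) using (unique?)

  -- The leading `L` is there because every walk comes from the fictitious column, hence reaches
  -- each column from the left.
  Letter : List (Cell h) → Set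
  Letter c = Linked _—_ (L ∷ c) × Unique (heights c)

  letter? : U.Decidable Letter
  letter? c = linked? _—?_ (L ∷ c) ×-dec unique? (heights c)

  slack : Cell h → ℕ
  slack (at _) = 1
  slack L      = 0
  slack R      = 0

  -- Since marks are not adjacent, at most one mark follows each height. `slack` pays for a mark
  -- directly after `p`, possible only if `p` is itself a height.
  length≤heights : ∀ p c → Linked _—_ (p ∷ c) → length c ≤ slack p ℕ.+ 2 ℕ.* length (heights c)
  length≤heights p []         _ = z≤n
  length≤heights _ (L ∷ c) (at-L ∷ l) = s≤s (length≤heights L c l)
  length≤heights _ (R ∷ c) (at-R ∷ l) = s≤s (length≤heights R c l)
  length≤heights p (at y ∷ c) (_ ∷ l) = begin
    suc (length c)                        ≤⟨ s≤s (length≤heights (at y) c l) ⟩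
    2 ℕ.+ 2 ℕ.* length (heights c)            ≡⟨ ℕ.*-suc 2 (length (heights c)) ⟨
    2 ℕ.* suc (length (heights c))          ≤⟨ ℕ.m≤n+m _ (slack p) ⟩
    slack p ℕ.+ 2 ℕ.* suc (length (heights c)) ∎
    where open ℕ.≤-Reasoning

  cells : List (Cell h)
  cells = L ∷ R ∷ map at (allFin h)

  cells-unique : Unique cells
  cells-unique =
    ((λ ()) ∷ All.map⁺ (All.tabulate λ _ ())) ∷
    All.map⁺ (All.tabulate λ _ ()) ∷
    Unique.map⁺ (λ { refl → refl }) (Unique.allFin⁺ h)

  ∈-cells : ∀ p → p ∈ cells
  ∈-cells L      = here refl
  ∈-cells R      = there (here refl)
  ∈-cells (at y) = there (there (∈-map⁺ at (∈-allFin y)))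

  -- A trace has at most `h` heights, as they are distinct, so by `length≤heights` after `L` its
  -- length is at most twice that.
  letters : List (List (Cell h))
  letters = filter letter? (words≤ cells (2 ℕ.* h))

  letters-unique : Unique letters
  letters-unique = Unique.filter⁺ letter? (words≤-unique cells-unique (2 ℕ.* h))

  ∈-letters : ∀ {c} → Letter c → c ∈ letters
  ∈-letters {c} (l , u) = ∈-filter⁺ letter?
    (∈-words≤ (All.universal ∈-cells c) (ℕ.≤-trans (length≤heights L c l) (ℕ.*-monoʳ-≤ 2 few))) (l , u)
    where
    few : length (heights c) ≤ h
    few = ℕ.≤-trans (Unique∧⊆⇒length≤ u (λ {y} _ → ∈-allFin y)) (ℕ.≤-reflexive (List.length-tabulate id))

  letters-sound : ∀ {c} → c ∈ letters → Letter c
  letters-sound c∈ = proj₂ (∈-filter⁻ letter? {xs = words≤ cells (2 ℕ.* h)} c∈)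

  -- The trapping condition of a walk ending in this column involves the two
  -- neighbouring ones.
  record Compatible (b c : List (Cell h)) : Set where
    constructor compatible
    field
      entry : crossings mirror L b ≡ crossings id L c
      below : ∀ y → end L c ≡ at y → y ∈ heights b
      level : ∀ y → end L c ≡ at y → ∀ y′ → Adjacent {h} (0 , y) (0 , y′) → y′ ∈ heights c
      above : ∀ y → end L b ≡ at y → y ∈ heights c

  compatible? : Decidable Compatible
  compatible? b c = map′ (λ (e , p , q , r) → compatible e p q r) (λ (compatible e p q r) → e , p , q , r)
    (List.≡-dec Fin._≟_ _ _ ×-dec
     Fin.all? (λ y → end L c ≟ᶜ at y →-dec y ∈? heights b) ×-dec
     Fin.all? (λ y → end L c ≟ᶜ at y →-dec
       Fin.all? (λ y′ → (_ ℕ.≟ 1) →-dec y′ ∈? heights c)) ×-dec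
     Fin.all? (λ y → end L b ≟ᶜ at y →-dec y ∈? heights c))

  -- The walks w with n vertices in the first d columns which end trapped, when b is the
  -- trace of the whole walk on the column to their left.
  record Good (b : List (Cell h)) (n d : ℕ) (w : List (Item h)) : Set where
    constructor good
    field
      linked  : Linked Step (nothing ∷ w)
      unique  : Unique (catMaybes w)
      entry   : crossings mirror L b ≡ crossings kind nothing w
      below   : ∀ y → end nothing w ≡ just (0 , y) → y ∈ heights b
      trapped : ∀ v u → end nothing w ≡ just v → Adjacent v u → u ∈ catMaybes w
      above   : ∀ y → end L b ≡ at y → (0 , y) ∈ catMaybes w
      size    : length (catMaybes w) ≡ n
      narrow  : All (λ v → proj₁ v < d) (catMaybes w)

  count-base : List (Cell h) → ℕ → ℕ
  count-base b zero    = if does (compatible? b []) then 1 else 0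
  count-base b (suc n) = 0

  -- `d` bounds the columns without being attained: a walk that reaches fewer of them continues with
  -- empty traces, and the empty trace can follow itself.
  number : List (Cell h) → ℕ → ℕ → ℕ
  number b n zero    = count-base b n
  number b n (suc d) = sum (map (λ c →
    if does (compatible? b c) then shiftℕ (length (heights c)) (λ m → number c m d) n else 0) letters)

  no-vertices : ∀ {w} → Linked (Step {h}) (nothing ∷ w) → All (λ v → proj₁ v < 0) (catMaybes w) → w ≡ []
  no-vertices [-]         _        = refl
  no-vertices (enter ∷ _) (() ∷ _)

  good-base : ∀ b n → Count (Good b n 0) (count-base b n)
  good-base b (suc n) = count-∅ λ w g → let open Good g in
    ℕ.0≢1+n (trans (cong (length ∘ catMaybes) (sym (no-vertices linked narrow))) size)
  good-base b zero = count-if (compatible? b [])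
    (λ (compatible e p q r) → count-singleton []
      (good [-] [] e (λ _ ()) (λ _ _ ()) (λ y eq → contradiction (r y eq) λ ()) refl [])
      (λ w g → no-vertices (Good.linked g) (Good.narrow g)))
    (λ ¬compat → count-∅ λ w g → ¬compat (compat w g (no-vertices (Good.linked g) (Good.narrow g))))
    where
    compat : ∀ w → Good b 0 0 w → w ≡ [] → Compatible b []
    compat _ g refl = compatible (Good.entry g) (λ _ ()) (λ _ ())
      (λ y eq → contradiction (Good.above g y eq) λ ())

  ends-column : ∀ {p a b} {y : Fin h} → Ends p a b → b ≡ just (0 , y) → p ≡ at y
  ends-column (column (just _)) refl = refl
  ends-column (column nothing)  ()
  ends-column (beyond _)        ()

  ends-column⁻ : ∀ {p a b} {y : Fin h} → Ends p a b → p ≡ at y → b ≡ just (0 , y)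
  ends-column⁻ (column (just _)) refl = refl
  ends-column⁻ (column nothing)  ()
  ends-column⁻ (beyond _)        ()

  ends-right : ∀ {p a b x} {y : Fin h} → Ends p a b → b ≡ just (suc x , y) → a ≡ just (x , y)
  ends-right (column (just _)) ()
  ends-right (column nothing)  ()
  ends-right (beyond _)        refl = refl

  ends-right⁻ : ∀ {p a b} {v : Vertex h} → Ends p a b → a ≡ just v → b ≡ just (right v)
  ends-right⁻ (beyond _) refl = refl

  module _ {c : List (Cell h)} {w′ w} (o : Out nothing c w′ w) where

    private
      vertices↭ : catMaybes w ↭ column₀ c ++ map right (catMaybes w′)
      vertices↭ = out-vertices o

    ∈-column⁺ : ∀ {y} → y ∈ heights c → (0 , y) ∈ catMaybes w
    ∈-column⁺ y∈ = ∈-resp-↭ (↭-sym vertices↭) (∈-++⁺ˡ (∈-map⁺ (0 ,_) y∈))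

    ∈-right⁺ : ∀ {v} → v ∈ catMaybes w′ → right v ∈ catMaybes w
    ∈-right⁺ v∈ = ∈-resp-↭ (↭-sym vertices↭) (∈-++⁺ʳ (column₀ c) (∈-map⁺ right v∈))

    ∈-column⁻ : ∀ {y} → (0 , y) ∈ catMaybes w → y ∈ heights c
    ∈-column⁻ y∈ with ∈-++⁻ (column₀ c) (∈-resp-↭ vertices↭ y∈)
    ... | inj₁ y∈c with ∈-map⁻ (0 ,_) y∈c
    ...   | _ , y∈′ , refl = y∈′
    ∈-column⁻ y∈ | inj₂ y∈w with ∈-map⁻ right y∈w
    ...   | _ , _ , ()

    ∈-right⁻ : ∀ {v} → right v ∈ catMaybes w → v ∈ catMaybes w′
    ∈-right⁻ v∈ with ∈-++⁻ (column₀ c) (∈-resp-↭ vertices↭ v∈)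
    ... | inj₁ v∈c with ∈-map⁻ (0 ,_) v∈c
    ...   | _ , _ , ()
    ∈-right⁻ v∈ | inj₂ v∈w with ∈-map⁻ right v∈w
    ...   | _ , v∈′ , refl = v∈′

    size-out : length (catMaybes w) ≡ length (heights c) ℕ.+ length (catMaybes w′)
    size-out = trans (↭-length vertices↭) (trans (length-++ (column₀ c))
      (cong₂ ℕ._+_ (length-map {B = Vertex h} (0 ,_) (heights c)) (length-map right (catMaybes w′))))

    unique-out⁺ : Unique (heights c) → Unique (catMaybes w′) → Unique (catMaybes w)
    unique-out⁺ uc uw = PermutationSetoid.Unique-resp-↭ (≡-setoid _) (↭⇒↭ₛ (↭-sym vertices↭))
      (Unique.++⁺ (Unique.map⁺ (λ { refl → refl }) uc) (Unique.map⁺ (λ { refl → refl }) uw) disjoint)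
      where
      disjoint : ∀ {v} → ¬ (v ∈ column₀ c × v ∈ map right (catMaybes w′))
      disjoint (v∈c , v∈w) with ∈-map⁻ (0 ,_) v∈c | ∈-map⁻ right v∈w
      ... | _ , _ , refl | _ , _ , ()

    unique-out⁻ : Unique (catMaybes w) → Unique (heights c) × Unique (catMaybes w′)
    unique-out⁻ u with Unique-++⁻ (column₀ c) (PermutationSetoid.Unique-resp-↭ (≡-setoid _) (↭⇒↭ₛ vertices↭) u)
    ... | uc , uw = Unique.map⁻ uc , Unique.map⁻ uw

    narrow-out⁺ : ∀ {d} → All (λ v → proj₁ v < d) (catMaybes w′) → All (λ v → proj₁ v < suc d) (catMaybes w)
    narrow-out⁺ a = All-resp-↭ (↭-sym vertices↭)
      (All.++⁺ (All.map⁺ (All.tabulate λ _ → s≤s z≤n)) (All.map⁺ (All.map s≤s a)))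

    narrow-out⁻ : ∀ {d} → All (λ v → proj₁ v < suc d) (catMaybes w) → All (λ v → proj₁ v < d) (catMaybes w′)
    narrow-out⁻ a = All.map (λ { (s≤s v<) → v< }) (All.map⁻ (All.++⁻ʳ (column₀ c) (All-resp-↭ vertices↭ a)))

    glue-good : ∀ {b n d} → Letter c → Compatible b c → Good c n d w′ →
                Good b (length (heights c) ℕ.+ n) (suc d) w
    glue-good (_ , uc) compat g = record
      { linked  = out-linked o
      ; unique  = unique-out⁺ uc unique
      ; entry   = trans C.entry (out-crossingsᴸ o)
      ; below   = λ y eq → C.below y (ends-column ends eq)
      ; trapped = trapped-w
      ; above   = λ y eq → ∈-column⁺ (C.above y eq)
      ; size    = trans size-out (cong (length (heights c) ℕ.+_) size)
      ; narrow  = narrow-out⁺ narrow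
      }
      where
      module C = Compatible compat
      open Good g
      ends = out-ends o

      -- Four cases, by whether the end and its neighbour lie in column 0. `level` serves an end in
      -- column 0 within its column, `above` of the rest serves its right neighbour, and `below` of
      -- the rest serves the left neighbour of an end in column 1. Otherwise both lie beyond, where
      -- the rest is trapped.
      trapped-w : ∀ v u → end nothing w ≡ just v → Adjacent v u → u ∈ catMaybes w
      trapped-w (zero , y)  (zero , y′)   eq adj = ∈-column⁺ (C.level y (ends-column ends eq) y′ adj)
      trapped-w (zero , y)  (suc x′ , y′) eq adj with adjacent-across {x = x′} {y} {y′} adj
      ... | refl , refl = ∈-right⁺ (above y (ends-column ends eq))
      trapped-w (suc x , y) (zero , y′)   eq adj with adjacent-across′ {x = x} {y} {y′} adj
      ... | refl , refl = ∈-column⁺ (below y (ends-right ends eq))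
      trapped-w (suc x , y) (suc x′ , y′) eq adj = ∈-right⁺ (trapped (x , y) (x′ , y′) (ends-right ends eq) adj)

    good-letter : ∀ {b n d} → Good b n d w → Letter c
    good-letter g = out-linkedˡ o , proj₁ (unique-out⁻ (Good.unique g))

    good-compatible : ∀ {b n d} → Good b n d w → Compatible b c
    good-compatible g = record
      { entry = trans entry (sym (out-crossingsᴸ o))
      ; below = λ y eq → below y (ends-column⁻ ends eq)
      ; level = λ y eq y′ adj → ∈-column⁻ (trapped (0 , y) (0 , y′) (ends-column⁻ ends eq) adj)
      ; above = λ y eq → ∈-column⁻ (above y eq)
      }
      where
      open Good g
      ends = out-ends o

    -- `below` and `above` of the rest are instances of the trapping of `w`, along the edges between
    -- columns 0 and 1.
    good-rest : ∀ {b n d} → Good b n (suc d) w → Good c (length (catMaybes w′)) d w′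
    good-rest g = record
      { linked  = out-linkedʳ o
      ; unique  = proj₂ (unique-out⁻ unique)
      ; entry   = out-crossings o
      ; below   = λ y eq → ∈-column⁻ (trapped (1 , y) (0 , y) (ends-right⁻ ends eq) (across′ y))
      ; trapped = λ v u eq adj → ∈-right⁻ (trapped (right v) (right u) (ends-right⁻ ends eq) adj)
      ; above   = λ y eq → ∈-right⁻ (trapped (0 , y) (1 , y) (ends-column⁻ ends eq) (across y))
      ; size    = refl
      ; narrow  = narrow-out⁻ narrow
      }
      where
      open Good g
      ends = out-ends o

  -- For a fixed compatible letter, gluing is injective on the good rests, and its image consists of
  -- the good walks with that trace. The letter can be read off from the walk, so the summands count
  -- disjoint sets.
  good-step : ∀ b n d → (∀ c m → Count (Good c m d) (number c m d)) →
              Count (Good b n (suc d)) (number b n (suc d))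
  good-step b n d counts = count-⇔ glue peel (count-∃∈ letters-unique count-letter disjoint)
    where
    From : List (Cell h) → List (Item h) → Set
    From c w = Compatible b c ×
      ∃[ w′ ] (∃[ m ] length (heights c) ℕ.+ m ≡ n × Good c m d w′) × Out nothing c w′ w

    count-letter : ∀ {c} → c ∈ letters → Count (From c)
      (if does (compatible? b c) then shiftℕ (length (heights c)) (λ m → number c m d) n else 0)
    count-letter {c} c∈ = count-if (compatible? b c)
      (λ compat → count-⇔ (λ _ from → compat , from) (λ _ (_ , from) → from)
        (count-image (Out nothing c) (count-shiftℕ (counts c) (length (heights c)) n)
          (λ _ (_ , _ , g) → merge-out nothing (proj₁ (letters-sound c∈)) (Good.linked g) (Good.entry g))
          out-functional (λ o o′ → proj₂ (out-injective o o′))))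
      (λ ¬compat → count-∅ (λ _ (compat , _) → ¬compat compat))

    disjoint : ∀ {c c′ w} → From c w → From c′ w → c ≡ c′
    disjoint (_ , _ , _ , o) (_ , _ , _ , o′) = proj₁ (out-injective o o′)

    glue : ∀ w → (∃[ c ] c ∈ letters × From c w) → Good b n (suc d) w
    glue w (c , c∈ , compat , w′ , (m , refl , g) , o) = glue-good o (letters-sound c∈) compat g

    peel : ∀ w → Good b n (suc d) w → ∃[ c ] c ∈ letters × From c w
    peel w g with split-out nothing (Good.linked g)
    ... | c , w′ , o = c , ∈-letters (good-letter o g) , good-compatible o g , w′ ,
      (length (catMaybes w′) , trans (sym (size-out o)) (Good.size g) , good-rest o g) , o

  count-good : ∀ d b n → Count (Good b n d) (number b n d)
  count-good zero    b n = good-base b n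
  count-good (suc d) b n = good-step b n d (count-good d)

-- Walks from the corner

end-∷ʳ : {A : Set} (a : A) (as : List A) (b : A) → end a (as ∷ʳ b) ≡ b
end-∷ʳ a []       b = refl
end-∷ʳ a (c ∷ as) b = end-∷ʳ c as b

end-map : {A B : Set} (f : A → B) (a : A) (as : List A) → end (f a) (map f as) ≡ f (end a as)
end-map f a []       = refl
end-map f a (b ∷ as) = end-map f b as

last≡end : {A : Set} (a : A) (as : List A) → last (a ∷ as) ≡ end a as
last≡end a as with initLast as
... | []       = refl
... | bs ∷ʳ′ b = sym (end-∷ʳ a bs b)

foldr₁-⊔-< : ∀ x xs {e} → foldr₁ _⊔_ (x ∷ xs) < e → All (_< e) (x ∷ xs)
foldr₁-⊔-< x []       m<e = m<e ∷ []
foldr₁-⊔-< x (y ∷ xs) m<e =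
  ℕ.≤-<-trans (ℕ.m≤m⊔n x _) m<e ∷ foldr₁-⊔-< y xs (ℕ.≤-<-trans (ℕ.m≤n⊔m x _) m<e)

<-foldr₁-⊔ : ∀ x xs {e} → All (_< e) (x ∷ xs) → foldr₁ _⊔_ (x ∷ xs) < e
<-foldr₁-⊔ x []       (x<e ∷ _)   = x<e
<-foldr₁-⊔ x (y ∷ xs) (x<e ∷ xs<) = ℕ.⊔-lub x<e (<-foldr₁-⊔ y xs xs<)

foldr₁-⊓-0 : ∀ xs → foldr₁ _⊓_ (0 ∷ xs) ≡ 0
foldr₁-⊓-0 []       = refl
foldr₁-⊓-0 (x ∷ xs) = refl

module _ {h : ℕ} where

  -- The walk starts in column 0, so the smallest x-coordinate is 0.
  displacement : ∀ (y : Fin h) vs → ∥ (0 , y) ∷ vs ∥ ≡ foldr₁ _⊔_ (0 ∷ map proj₁ vs)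
  displacement y vs = cong (foldr₁ _⊔_ (0 ∷ map proj₁ vs) ∸_) (foldr₁-⊓-0 (map proj₁ vs))

  narrow⇒∥∥< : ∀ (y : Fin h) vs {e} → All (λ v → proj₁ v < e) ((0 , y) ∷ vs) → ∥ (0 , y) ∷ vs ∥ < e
  narrow⇒∥∥< y vs {e} (0<e ∷ vs<e) =
    subst (_< e) (sym (displacement y vs)) (<-foldr₁-⊔ 0 (map proj₁ vs) (0<e ∷ All.map⁺ vs<e))

  ∥∥<⇒narrow : ∀ (y : Fin h) vs {e} → ∥ (0 , y) ∷ vs ∥ < e → All (λ v → proj₁ v < e) ((0 , y) ∷ vs)
  ∥∥<⇒narrow y vs {e} m<e with foldr₁-⊔-< 0 (map proj₁ vs) (subst (_< e) (displacement y vs) m<e)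
  ... | 0<e ∷ vs<e = 0<e ∷ All.map⁻ vs<e

  emit-just : ∀ (u v : Vertex h) ys → emit (kind (just u)) (kind (just v)) ys ≡ ys
  emit-just (zero  , _) (zero  , _) ys = refl
  emit-just (zero  , _) (suc _ , _) ys = refl
  emit-just (suc _ , _) v           ys = refl

  crossings-just : ∀ (v : Vertex h) vs → crossings kind (just v) (map just vs) ≡ []
  crossings-just v []       = refl
  crossings-just v (u ∷ vs) = trans (emit-just v u _) (crossings-just u vs)

  -- Every `nothing` after `v` would be preceded by a crossing into it, so without crossings the
  -- items are plain vertices.
  no-crossings : ∀ v {w} → Linked (Step {h}) (just v ∷ w) → crossings kind (just v) w ≡ [] →
                 ∃[ vs ] w ≡ map just vs
  no-crossings v [-] _ = [] , refl
  no-crossings _ (leave ∷ s) ()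
  no-crossings v (move {v = u} _ ∷ s) eq with no-crossings u s (trans (sym (emit-just v u _)) eq)
  ... | vs , refl = u ∷ vs , refl

  linked-just : ∀ {v : Vertex h} {vs} → Linked Adjacent (v ∷ vs) → Linked Step (map just (v ∷ vs))
  linked-just [-]       = [-]
  linked-just (adj ∷ l) = move adj ∷ linked-just l

  linked-just⁻ : ∀ {v : Vertex h} {vs} → Linked Step (map just (v ∷ vs)) → Linked Adjacent (v ∷ vs)
  linked-just⁻ {vs = []}    [-]            = [-]
  linked-just⁻ {vs = _ ∷ _} (move adj ∷ l) = adj ∷ linked-just⁻ l

  -- The column to the left of the corner: it is fully visited, so that no walk can
  -- escape there, and left at height t.
  outer : Fin h → List (Cell h)
  outer t = map at (allFin h) ++ at t ∷ R ∷ []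

  -- The final `at t` and `R` form the only crossing, so a walk to the right enters at `t` and never
  -- returns.
  outer-entry : ∀ t → crossings mirror L (outer t) ≡ [ t ]
  outer-entry t = from-L (allFin h)
    where
    from-at : ∀ y ys → crossings mirror (at y) (map at ys ++ at t ∷ R ∷ []) ≡ [ t ]
    from-at y []        = refl
    from-at y (y′ ∷ ys) = from-at y′ ys

    from-L : ∀ ys → crossings mirror L (map at ys ++ at t ∷ R ∷ []) ≡ [ t ]
    from-L []       = refl
    from-L (y ∷ ys) = from-at y ys

  -- Ending in `R` makes the condition `above` of `Good` vacuous: no walk ends in the fictitious
  -- column.
  outer-end : ∀ t → end L (outer t) ≡ R
  outer-end t = go L (map at (allFin h))
    where
    go : ∀ p c → end p (c ++ at t ∷ R ∷ []) ≡ R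
    go p []      = refl
    go p (q ∷ c) = go q c

  outer-heights : ∀ t y → y ∈ heights (outer t)
  outer-heights t y = go (∈-allFin y)
    where
    go : ∀ {ys} → y ∈ ys → y ∈ heights (map at ys ++ at t ∷ R ∷ [])
    go (here refl) = here refl
    go (there y∈)  = there (go y∈)

  Straight : List⁺ (Vertex h) → List (Item h) → Set
  Straight W w = w ≡ map just (toList W)

  straight-functional : ∀ {W w w′} → Straight W w → Straight W w′ → w ≡ w′
  straight-functional refl refl = refl

  straight-injective : ∀ {W W′ w} → Straight W w → Straight W′ w → W ≡ W′
  straight-injective {v ∷ vs} {v′ ∷ vs′} refl eq with ∷-injective (List.map-injective just-injective eq)
  ... | refl , refl = refl

  module _ (t : Fin h) where

    gsaw⇒good : ∀ {vs d} → IsGSAW Adjacent ((0 , t) ∷ vs) → ∥ (0 , t) ∷ vs ∥ < d →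
                Good (outer t) (suc (length vs)) d (map just ((0 , t) ∷ vs))
    gsaw⇒good {vs} {d} (mkGSAW walk self-avoiding trapped) ∥∥<d = record
      { linked  = enter ∷ linked-just walk
      ; unique  = subst Unique (sym vertices) self-avoiding
      ; entry   = trans (outer-entry t) (cong (t ∷_) (sym (crossings-just (0 , t) vs)))
      ; below   = λ y _ → outer-heights t y
      ; trapped = λ v u eq adj → subst (u ∈_) (sym vertices)
                    (trapped u (subst (λ l → Adjacent l u) (sym (last-is v eq)) adj))
      ; above   = λ y eq → contradiction (trans (sym (outer-end t)) eq) λ ()
      ; size    = cong length vertices
      ; narrow  = subst (All (λ v → proj₁ v < d)) (sym vertices) (∥∥<⇒narrow t vs ∥∥<d)
      }
      where
      vertices : catMaybes (map just ((0 , t) ∷ vs)) ≡ (0 , t) ∷ vs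
      vertices = List.mapMaybe-just ((0 , t) ∷ vs)

      last-is : ∀ v → end (just (0 , t)) (map just vs) ≡ just v → last ((0 , t) ∷ vs) ≡ v
      last-is v eq = trans (last≡end _ vs) (just-injective (trans (sym (end-map just (0 , t) vs)) eq))

    -- The list of crossings is the singleton `t`. This forces the first vertex to be in column 0 at
    -- height `t` and leaves no crossing for the rest, so `no-crossings` applies.
    good⇒gsaw : ∀ {n d w} → Good (outer t) n d w →
                ∃[ vs ] w ≡ map just ((0 , t) ∷ vs) × IsGSAW Adjacent ((0 , t) ∷ vs) ×
                        n ≡ suc (length vs) × ∥ (0 , t) ∷ vs ∥ < d
    good⇒gsaw {w = w} (good linked unique entry below trapped above size narrow)
      with w | linked | trans (sym (outer-entry t)) entry
    ... | [] | [-] | ()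
    ... | just (0 , _) ∷ w₁ | enter ∷ l | eq with ∷-injective eq
    ... | refl , eq′ with no-crossings (0 , t) l (sym eq′)
    ... | vs , refl = vs , refl , mkGSAW (linked-just⁻ l) (subst Unique vertices unique) trapped′ ,
      trans (sym size) (cong length vertices) , narrow⇒∥∥< t vs (subst (All _) vertices narrow)
      where
      vertices : catMaybes (map just ((0 , t) ∷ vs)) ≡ (0 , t) ∷ vs
      vertices = List.mapMaybe-just ((0 , t) ∷ vs)

      trapped′ : ∀ u → Adjacent (last ((0 , t) ∷ vs)) u → u ∈ (0 , t) ∷ vs
      trapped′ u adj = subst (u ∈_) vertices
        (trapped _ u (trans (end-map just (0 , t) vs) (cong just (sym (last≡end _ vs)))) adj)

    -- The forced crossing at `t` produces a vertex, so no good walk is empty.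
    number-zero : ∀ d → number (outer t) 0 d ≡ 0
    number-zero d = count-≡ (count-good d (outer t) 0) (count-∅ none) (λ _ → mk⇔ id id)
      where
      none : ∀ w → ¬ Good (outer t) 0 d w
      none w g with good⇒gsaw g
      ... | _ , _ , _ , () , _

  -- Displacement at most `d` is either exactly `d` or less than `d`. The first index is `suc n`
  -- because a walk with n edges has n + 1 vertices.
  number-step : .{{_ : NonZero h}} → ∀ t → topLeft h ≡ (0 , t) → ∀ n d →
    number (outer t) (suc n) (suc d) ≡
    Enumeration.cardinality (cornerGSAWs {h} n d) ℕ.+ number (outer t) (suc n) d
  number-step t corner n d = count-≡ (count-good (suc d) (outer t) (suc n))
    (count-⊎ (count-image Straight (cornerGSAWs n d , refl) (λ W _ → _ , refl)
               straight-functional straight-injective)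
             (count-good d (outer t) (suc n)) disjoint)
    (λ w → mk⇔ (split w) (unsplit w))
    where
    Exact : List (Item h) → Set
    Exact w = ∃[ W ] CornerGSAW h n d W × Straight W w

    disjoint : ∀ w → Exact w → ¬ Good (outer t) (suc n) d w
    disjoint _ ((v ∷ vs) , (_ , _ , refl) , refl) g with good⇒gsaw t g
    ... | vs′ , eq , _ , _ , ∥∥<d with straight-injective {v ∷ vs} {(0 , t) ∷ vs′} refl eq
    ... | refl = ℕ.<-irrefl refl ∥∥<d

    split : ∀ w → Good (outer t) (suc n) (suc d) w → Exact w ⊎ Good (outer t) (suc n) d w
    split w g with good⇒gsaw t g
    ... | vs , refl , gsaw , refl , s≤s ∥∥≤d with ℕ.m≤n⇒m<n∨m≡n ∥∥≤d
    ... | inj₁ ∥∥<d = inj₂ (gsaw⇒good t gsaw ∥∥<d)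
    ... | inj₂ refl = inj₁ (_ , ((gsaw , sym corner) , refl , refl) , refl)

    unsplit : ∀ w → Exact w ⊎ Good (outer t) (suc n) d w → Good (outer t) (suc n) (suc d) w
    unsplit w (inj₁ ((v ∷ vs) , ((gsaw , start) , refl , refl) , refl)) with trans start corner
    ... | refl = gsaw⇒good t gsaw (ℕ.≤-refl)
    unsplit w (inj₂ g) with good⇒gsaw t g
    ... | vs , refl , gsaw , refl , ∥∥<d = gsaw⇒good t gsaw (ℕ.m≤n⇒m≤1+n ∥∥<d)

  -- The linear system of the generating functions

  numberSeries : List (Cell h) → PowerSeries
  numberSeries b i j = + number b i j

  baseSeries : List (Cell h) → PowerSeries
  baseSeries b = if does (compatible? b []) then 1# else 0#

  transfer : List (Cell h) → List (Cell h) → PowerSeries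
  transfer b c = if does (compatible? b c) then X^ (length (heights c)) * Y else 0#

  -- The factor `Y` makes the constant coefficient vanish, even for the empty trace, where the power
  -- of X is 1.
  Poly-transfer : ∀ b c → Poly 0ℤ (transfer b c)
  Poly-transfer b c with does (compatible? b c)
  ... | true  = subst (λ z → Poly z (X^ (length (heights c)) * Y)) (ℤ.*-zeroʳ (X^ (length (heights c)) 0 0))
                  (Poly-* (Poly-X^ (length (heights c)) , refl) Poly-Y)
  ... | false = Poly-0

  base-zero : ∀ b i → + count-base b i ≡ baseSeries b i 0
  base-zero b zero with does (compatible? b [])
  ... | true  = refl
  ... | false = refl
  base-zero b (suc i) with does (compatible? b [])
  ... | true  = refl
  ... | false = refl

  base-suc : ∀ b i j → 0ℤ ≡ baseSeries b i (suc j)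
  base-suc b i j with does (compatible? b [])
  base-suc b zero    j | true = refl
  base-suc b (suc i) j | true = refl
  ... | false = refl

  shiftX-Y : ∀ a F i j → (X^ a * Y * F) i j ≡ shiftX a (Y * F) i j
  shiftX-Y a F i j = trans (*-assoc (X^ a) Y F i j) (X^-* a (Y * F) i j)

  shiftX-0 : ∀ a {F} i → (∀ i → F i 0 ≡ 0ℤ) → shiftX a F i 0 ≡ 0ℤ
  shiftX-0 zero    i       eq = eq i
  shiftX-0 (suc a) zero    eq = refl
  shiftX-0 (suc a) (suc i) eq = shiftX-0 a i eq

  shiftX-suc : ∀ a {F} {f : ℕ → ℕ} i j → (∀ i → F i j ≡ + f i) → shiftX a F i j ≡ + shiftℕ a f i
  shiftX-suc zero    i       j eq = eq i
  shiftX-suc (suc a) zero    j eq = refl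
  shiftX-suc (suc a) (suc i) j eq = shiftX-suc a i j eq

  transfer-zero : ∀ b c i → (transfer b c * numberSeries c) i 0 ≡ 0ℤ
  transfer-zero b c i with does (compatible? b c)
  ... | true  = trans (shiftX-Y (length (heights c)) (numberSeries c) i 0)
                  (shiftX-0 (length (heights c)) i (λ i → Y-* (numberSeries c) i 0))
  ... | false = zeroˡ (numberSeries c) i 0

  transfer-suc : ∀ b c i j → (transfer b c * numberSeries c) i (suc j) ≡
    + (if does (compatible? b c) then shiftℕ (length (heights c)) (λ m → number c m j) i else 0)
  transfer-suc b c i j with does (compatible? b c)
  ... | true  = trans (shiftX-Y (length (heights c)) (numberSeries c) i (suc j))
                  (shiftX-suc (length (heights c)) i (suc j) (λ i → Y-* (numberSeries c) i (suc j)))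
  ... | false = zeroˡ (numberSeries c) i (suc j)

  Σ-zero : ∀ b i cs → Σ[ cs ] (λ c → transfer b c * numberSeries c) i 0 ≡ 0ℤ
  Σ-zero b i []       = refl
  Σ-zero b i (c ∷ cs) = cong₂ ℤ._+_ (transfer-zero b c i) (Σ-zero b i cs)

  Σ-suc : ∀ b i j cs → Σ[ cs ] (λ c → transfer b c * numberSeries c) i (suc j) ≡
    + sum (map (λ c → if does (compatible? b c)
                      then shiftℕ (length (heights c)) (λ m → number c m j) i else 0) cs)
  Σ-suc b i j []       = refl
  Σ-suc b i j (c ∷ cs) = cong₂ ℤ._+_ (transfer-suc b c i j) (Σ-suc b i j cs)

  -- Compared by powers of y: at exponent 0 the transfer terms vanish and the base remains, and at a
  -- successor the base vanishes and the recursion of `number` remains. The factor 1 is the initial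
  -- `D` of `elimination`.
  number-equation : ∀ b → 1# * numberSeries b ≈
    baseSeries b + Σ[ letters ] (λ c → transfer b c * numberSeries c)
  number-equation b i zero    = trans (*-identityˡ (numberSeries b) i 0)
    (trans (sym (ℤ.+-identityʳ _)) (cong₂ ℤ._+_ (base-zero b i) (sym (Σ-zero b i letters))))
  number-equation b i (suc j) = trans (*-identityˡ (numberSeries b) i (suc j))
    (trans (sym (ℤ.+-identityˡ _)) (cong₂ ℤ._+_ (base-suc b i j) (sym (Σ-suc b i j letters))))

  -- Multiplying by 1 - Y takes differences in the number of columns, which isolates the walks of
  -- exact displacement. X accounts for vertices against edges, Y for columns against displacement.
  shift-equation : .{{_ : NonZero h}} → ∀ t → topLeft h ≡ (0 , t) →
    X * (Y * gsawSeries h) ≈ (1# - Y) * numberSeries (outer t)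
  shift-equation t corner i j = trans (left-side i j) (trans (compare i j) (sym (right-side i j)))
    where
    F = numberSeries (outer t)
    f = gsawSeries h

    left-side : ∀ i j → (X * (Y * f)) i j ≡ Bivariate.shift (λ i → Univariate.shift (f i)) i j
    left-side zero    j = Bivariate.indeterminate-∙ (Y * f) zero j
    left-side (suc i) j = trans (Bivariate.indeterminate-∙ (Y * f) (suc i) j) (Y-* f i j)

    right-side : ∀ i j → ((1# - Y) * F) i j ≡ F i j ℤ.- Univariate.shift (F i) j
    right-side i j = trans (distribʳ F 1# (- Y) i j)
      (cong₂ ℤ._+_ (*-identityˡ F i j)
        (trans (sym (-‿distribˡ-* Y F i j)) (cong ℤ.-_ (Y-* F i j))))

    compare : ∀ i j → Bivariate.shift (λ i → Univariate.shift (f i)) i j ≡ F i j ℤ.- Univariate.shift (F i) j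
    compare zero    zero    = cong (λ m → + m ℤ.- 0ℤ) (sym (number-zero t 0))
    compare zero    (suc j) = cong₂ (λ m m′ → + m ℤ.- + m′) (sym (number-zero t (suc j))) (sym (number-zero t j))
    -- With no column available, `count-base` is 0 for a positive number of vertices by computation.
    compare (suc i) zero    = refl
    compare (suc i) (suc j) = sym (trans (cong (λ m → + m ℤ.- F (suc i) j) (number-step t corner i j))
      (cancel (f i j) (F (suc i) j)))
      where
      cancel : ∀ a b → a ℤ.+ b ℤ.- b ≡ a
      cancel a b = trans (ℤ.+-assoc a b (ℤ.- b))
        (trans (cong (λ z → a ℤ.+ z) (ℤ.+-inverseʳ b)) (ℤ.+-identityʳ a))

numberSeries-rational : ∀ {h} (b : List (Cell h)) →
  ∃₂ λ q p → Poly 1ℤ q × IsPolynomial p × q * numberSeries b ≈ p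
numberSeries-rational = elimination letters numberSeries (λ _ → 1#) baseSeries transfer
  (λ _ → Poly-1) (λ b → Poly-if (does (compatible? b [])) (proj₁ Poly-1)) Poly-transfer number-equation

theorem4p1 : (h : ℕ) → .{{_ : NonZero h}} → IsRational (gsawSeries h)
theorem4p1 h@(suc k) =
  -- With `h` a successor, the corner computes to column 0 and height `fromℕ k`, which gives the
  -- `refl`.
  let q , p , q1 , pp , qF≈p = numberSeries-rational (outer (fromℕ k))
  in rational-from-shift (gsawSeries h) (numberSeries (outer (fromℕ k))) q1 pp qF≈p
       (shift-equation (fromℕ k) refl)
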